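{- Let $G(I,P;E)$ be a pinned graph satisfying the Pinned Framework Conditions. Identify all pinned vertices to a single vertex $p^*$, obtaining the (multi)graph $G^*=(V,E)$ with $V=I\cup\{p^*\}$. Then the degree of freedom (DOF) of $G^*$ equals one less than the number of rigidity circuits contained in $G^*$.
   Context: A pinned graph $G(I,P;E)$ consists of a finite set $I$ of inner vertices, a finite set $P$ of pinned vertices (disjoint from $I$), and a finite set $E$ of edges, each joining two distinct vertices and having at least one endpoint in $I$. For a nonempty $E'\subseteq E$, let $I'$, $P'$ be the inner and pinned vertices incident to $E'$. $G$ satisfies the Pinned Framework Conditions if $|E|=2|I|$ and for every nonempty $E'\subseteq E$: $|E'|\le 2|I'|$ if $|P'|\ge2$; $|E'|\le 2|I'|-1$ if $|P'|=1$; $|E'|\le 2|I'|-3$ if $P'=\emptyset$. For a (multi)graph $H$ on $n$ vertices placed at points $\mathbf{p}_1,\dots,\mathbf{p}_n\in\mathbb{R}^2$, the rigidity matrix has one row per edge $(i,j)$, with $\mathbf{p}_i-\mathbf{p}_j$ in the two columns of $i$, $\mathbf{p}_j-\mathbf{p}_i$ in the two columns of $j$, zeros elsewhere. For a generic placement, linear (in)dependence of rows defines the generic 2-dimensional rigidity matroid on the edges; its rank $\rho$ depends only on $H$, and the DOF of $H$ is $2n-3-\rho$. A rigidity circuit is a minimally dependent edge set of this matroid; equivalently a nonempty edge set $C$ with $|C|=2|V(C)|-2$ such that every nonempty proper subset $F\subsetneq C$ satisfies $|F|\le 2|V(F)|-3$ (here $V(F)$ is the set of vertices incident to $F$).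
   Formalization: The vertices are placed at rational instead of real points of the plane, and an edge set counts as independent in the generic rigidity matroid if its rows are linearly independent over the rationals at some rational placement. -}

module Defs where

open import Data.Nat using (ℕ; zero; suc; _+_; _*_; _≤_)
open import Data.Bool using (Bool; true; false; _∧_; _∨_; if_then_else_)
open import Data.Fin using (Fin; zero; suc; _≟_)
open import Data.Fin.Subset using (Subset; ∣_∣; Nonempty; _⊂_)
open import Data.Vec using (lookup; tabulate)
open import Data.Sum using (_⊎_; inj₁; inj₂)
open import Data.Product using (_×_; _,_; proj₁; proj₂; Σ; ∃; ∃-syntax)
open import Data.Rational using (ℚ; 0ℚ) renaming (_+_ to _+ℚ_; _*_ to _*ℚ_; _-_ to _-ℚ_)
open import Data.Integer using (ℤ; +_) renaming (_-_ to _-ℤ_)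
open import Data.List using (List; length)
open import Data.List.Membership.Propositional using (_∈_)
open import Data.List.Relation.Unary.Unique.Propositional using (Unique)
open import Function.Bundles using (_⇔_)
open import Relation.Nullary using (¬_; does)
open import Relation.Binary.PropositionalEquality using (_≡_; _≢_)

-- Pinned graphs
--
-- Inner vertices: Fin ni, pinned vertices: Fin np, edges: Fin m.
-- Every edge has at least one inner endpoint; we record edge e as
-- (inner endpoint , other endpoint), the other endpoint being inner
-- (inj₁) or pinned (inj₂).  The two endpoints are distinct.

record PinnedGraph : Set where
  field
    ni np m  : ℕ
    inner    : Fin m → Fin ni
    other    : Fin m → Fin ni ⊎ Fin np
    distinct : ∀ e j → other e ≡ inj₁ j → inner e ≢ j

open PinnedGraph public

anyFin : ∀ {k} → (Fin k → Bool) → Bool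
anyFin {zero}  f = false
anyFin {suc k} f = f zero ∨ anyFin (λ i → f (suc i))

module _ (G : PinnedGraph) where

  incInner : Fin (m G) → Fin (ni G) → Bool
  incInner e i with other G e
  ... | inj₁ j = does (inner G e ≟ i) ∨ does (j ≟ i)
  ... | inj₂ _ = does (inner G e ≟ i)

  incPinned : Fin (m G) → Fin (np G) → Bool
  incPinned e q with other G e
  ... | inj₁ _ = false
  ... | inj₂ r = does (r ≟ q)

  innerOf : Subset (m G) → Subset (ni G)
  innerOf E' = tabulate λ i → anyFin λ e → lookup E' e ∧ incInner e i

  pinnedOf : Subset (m G) → Subset (np G)
  pinnedOf E' = tabulate λ q → anyFin λ e → lookup E' e ∧ incPinned e q

  record PFC : Set where
    field
      count : m G ≡ 2 * ni G
      sparse2 : ∀ (E' : Subset (m G)) → Nonempty E' → 2 ≤ ∣ pinnedOf E' ∣ →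
                ∣ E' ∣ ≤ 2 * ∣ innerOf E' ∣
      sparse1 : ∀ (E' : Subset (m G)) → Nonempty E' → ∣ pinnedOf E' ∣ ≡ 1 →
                ∣ E' ∣ + 1 ≤ 2 * ∣ innerOf E' ∣
      sparse0 : ∀ (E' : Subset (m G)) → Nonempty E' → ∣ pinnedOf E' ∣ ≡ 0 →
                ∣ E' ∣ + 3 ≤ 2 * ∣ innerOf E' ∣

  -- The multigraph G* : vertices Fin (suc ni), p* = zero, inner i ↦ suc i.
  -- Edge e of G* has endpoints (tail* e , head* e); same edge set Fin m.

  tail* : Fin (m G) → Fin (suc (ni G))
  tail* e = suc (inner G e)

  head* : Fin (m G) → Fin (suc (ni G))
  head* e with other G e
  ... | inj₁ j = suc j
  ... | inj₂ _ = zero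

  Placement : Set
  Placement = Fin (suc (ni G)) → ℚ × ℚ

  coord : ℚ × ℚ → Fin 2 → ℚ
  coord x zero = proj₁ x
  coord x (suc _) = proj₂ x

  -- entry of the rigidity matrix: row e, column (vertex w, coordinate c)
  entry : Placement → Fin (m G) → Fin (suc (ni G)) → Fin 2 → ℚ
  entry p e w c =
    (if does (w ≟ tail* e) then coord (p (tail* e)) c -ℚ coord (p (head* e)) c else 0ℚ)
    +ℚ
    (if does (w ≟ head* e) then coord (p (head* e)) c -ℚ coord (p (tail* e)) c else 0ℚ)

  sumFin : ∀ {k} → (Fin k → ℚ) → ℚ
  sumFin {zero}  f = 0ℚ
  sumFin {suc k} f = f zero +ℚ sumFin (λ i → f (suc i))

  IndepAt : Placement → Subset (m G) → Set
  IndepAt p S = ∀ (λ' : Fin (m G) → ℚ) →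
    (∀ w c → sumFin (λ e → if lookup S e then λ' e *ℚ entry p e w c else 0ℚ) ≡ 0ℚ) →
    ∀ e → lookup S e ≡ true → λ' e ≡ 0ℚ

  -- independent in the generic rigidity matroid
  -- (independent at a generic placement ⇔ independent at some placement)
  Independent : Subset (m G) → Set
  Independent S = ∃[ p ] IndepAt p S

  IsCircuit : Subset (m G) → Set
  IsCircuit C = ¬ Independent C × (∀ F → F ⊂ C → Independent F)

  IsRank : ℕ → Set
  IsRank ρ = (∃[ S ] (Independent S × ∣ S ∣ ≡ ρ))
           × (∀ S → Independent S → ∣ S ∣ ≤ ρ)

  DOF : ℕ → ℤ
  DOF ρ = + (2 * suc (ni G)) -ℤ + 3 -ℤ + ρ

  CircuitList : List (Subset (m G)) → Set
  CircuitList L = Unique L × (∀ C → (C ∈ L) ⇔ IsCircuit C)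

{-# OPTIONS --safe #-}
module Submission where

-- By Laman's theorem (Henneberg's induction on a vertex of degree at most 3) an edge set is
-- independent exactly when every vertex set X spans at most 2 |X| - 3 of its edges, if any.
-- The pinned framework conditions say that in G* every X spans at most 2 |X| - 2 edges, so a
-- circuit fills its vertex set up to this bound, and submodularity shows that distinct circuits
-- are disjoint.  Hence a basis arises by deleting one edge from each circuit, and the rank is
-- 2 |I| minus the number of circuits.

open import Defs
open import Data.Bool.Base using (Bool; true; false; if_then_else_; _∧_; not)
open import Data.Empty using (⊥; ⊥-elim)
open import Data.Fin.Base using (Fin; zero; suc)
import Data.Fin.Properties as FinP
import Data.Fin.Subset as Sub
import Data.Fin.Subset.Induction as SubI
import Data.Fin.Subset.Properties as SubP
import Data.Integer as ℤ
import Data.Integer.Properties as ℤP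
import Data.Integer.Tactic.RingSolver as ℤSolver
open import Data.List.Base using (List; []; _∷_; _++_; map; length; upTo; filterᵇ; allFin; cartesianProduct; filter)
open import Data.List.Membership.Propositional using (_∈_; find)
open import Data.List.Membership.Propositional.Properties using (∈-∃++; ∈-++⁻; ∈-++⁺ˡ; ∈-++⁺ʳ; ∈-map⁺; ∈-map⁻; ∈-allFin; ∈-cartesianProduct⁺; ∈-filter⁺; ∈-filter⁻)
open import Data.List.Properties using (map-∘; map-id; length-++; length-map; length-upTo; ∷-injectiveˡ; ∷-injectiveʳ)
import Data.List.Relation.Binary.Permutation.Propositional as Perm
open import Data.List.Relation.Binary.Permutation.Propositional using (_↭_; ↭-sym)
import Data.List.Relation.Binary.Permutation.Propositional.Properties as PermP
open import Data.List.Relation.Binary.Permutation.Propositional.Properties using (↭-map-inv; All-resp-↭)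
open import Data.List.Relation.Unary.All as All using (All; []; _∷_)
import Data.List.Relation.Unary.All.Properties as AllP
open import Data.List.Relation.Unary.Any as Any using (here; there)
open import Data.List.Relation.Unary.Unique.Propositional using (Unique; []; _∷_)
import Data.List.Relation.Unary.Unique.Propositional.Properties as UniqueP
import Data.Nat.Base as ℕ
open import Data.Nat.Base using (ℕ; zero; suc)
import Data.Nat.Coprimality as Coprime
import Data.Nat.Properties as ℕP
import Data.Nat.Tactic.RingSolver as ℕSolver
open import Data.Product.Base using (Σ; ∃; ∃₂; ∃-syntax; _×_; _,_; proj₁; proj₂)
import Data.Rational.Base as ℚ
import Data.Rational.Properties as ℚP
open import Data.Sum.Base using (_⊎_; inj₁; inj₂)
open import Data.Unit.Base using (tt) renaming (⊤ to Unit)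
import Data.Vec.Base as Vec
import Data.Vec.Properties as VecP
open import Function.Base using (_∘_; id)
open import Function.Bundles using (mk⇔)
open import Level using (0ℓ)
open import Relation.Binary.PropositionalEquality using (_≡_; _≢_; refl; sym; trans; cong; cong₂; subst; module ≡-Reasoning)
open import Relation.Nullary using (¬_; Dec; yes; no; does; ¬?)
open import Relation.Nullary.Decidable using (dec⇒maybe; decidable-stable; dec-true; dec-false; _×-dec_)
open import Tactic.RingSolver using (solve-∀)
open import Tactic.RingSolver.Core.AlmostCommutativeRing using (AlmostCommutativeRing; fromCommutativeRing)
open Sub using (Subset; ∣_∣; _∪_; _∩_; ⁅_⁆; _⊆_; ∁; _⊂_)

-- Independence asks for some rational placement, so the hard half of Laman's theorem is to keep a
-- placement stress-free while meeting the side condition of a Henneberg step: two points with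
-- different abscissae, or three points not on a line. No multivariate polynomials are needed. A
-- stress-free placement is joined by a straight line to one meeting the side condition; along it
-- both properties are governed by polynomials in one parameter, which are simultaneously nonzero at
-- some rational value. Edges are kept in lists, because a Henneberg step trades edges for a new one
-- that need not belong to the graph, and because G* may have parallel edges: two edges from an
-- inner vertex to different pinned vertices become a circuit with 2 = 2*2 - 2 edges. In the bound
-- 2|X| - 2 the vertex p* accounts for the 2: a set X containing p* has |X| - 1 inner vertices. With
-- k circuits the result is 2(|I| + 1) - 3 - (2|I| - k) = k - 1.

ℚ-ring : AlmostCommutativeRing 0ℓ 0ℓ
ℚ-ring = fromCommutativeRing ℚP.+-*-commutativeRing λ q → dec⇒maybe (ℚ.0ℚ ℚP.≟ q)

-- Finite sums of rationals over lists.

module Sums where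
  open ℚ using (ℚ; 0ℚ; 1ℚ; _+_; _*_; _-_; -_)
  open ≡-Reasoning

  private
    variable
      A B : Set

  *-nonzero-cancelˡ : ∀ {p q} → p ≢ 0ℚ → p * q ≡ 0ℚ → q ≡ 0ℚ
  *-nonzero-cancelˡ {p} {q} p≢0 pq≡0 = begin
    q                  ≡⟨ ℚP.*-identityˡ q ⟨
    1ℚ * q             ≡⟨ cong (_* q) (ℚP.*-inverseˡ p) ⟨
    (ℚ.1/ p) * p * q   ≡⟨ ℚP.*-assoc (ℚ.1/ p) p q ⟩
    (ℚ.1/ p) * (p * q) ≡⟨ cong ((ℚ.1/ p) *_) pq≡0 ⟩
    (ℚ.1/ p) * 0ℚ      ≡⟨ ℚP.*-zeroʳ (ℚ.1/ p) ⟩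
    0ℚ                 ∎
    where instance p-nonZero = ℚ.≢-nonZero p≢0

  *-≢0 : ∀ {p q} → p ≢ 0ℚ → q ≢ 0ℚ → p * q ≢ 0ℚ
  *-≢0 p≢0 q≢0 = q≢0 ∘ *-nonzero-cancelˡ p≢0

  factorˡ-≢0 : ∀ {p q} → p * q ≢ 0ℚ → p ≢ 0ℚ
  factorˡ-≢0 {q = q} pq≢0 refl = pq≢0 (ℚP.*-zeroˡ q)

  factorʳ-≢0 : ∀ {p q} → p * q ≢ 0ℚ → q ≢ 0ℚ
  factorʳ-≢0 {p = p} pq≢0 refl = pq≢0 (ℚP.*-zeroʳ p)

  difference-≢0 : ∀ {p q} → p ≢ q → p - q ≢ 0ℚ
  difference-≢0 {p} {q} p≢q p-q≡0 = p≢q (begin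
    p           ≡⟨ split p q ⟩
    (p - q) + q ≡⟨ cong (_+ q) p-q≡0 ⟩
    0ℚ + q      ≡⟨ ℚP.+-identityˡ q ⟩
    q           ∎)
    where
    split : ∀ p q → p ≡ (p - q) + q
    split = solve-∀ ℚ-ring

  ∑ : List A → (A → ℚ) → ℚ
  ∑ []       f = 0ℚ
  ∑ (x ∷ xs) f = f x + ∑ xs f

  ∑-cong : ∀ (xs : List A) {f g} → (∀ x → f x ≡ g x) → ∑ xs f ≡ ∑ xs g
  ∑-cong []       f≗g = refl
  ∑-cong (x ∷ xs) f≗g = cong₂ _+_ (f≗g x) (∑-cong xs f≗g)

  ∑-zero : ∀ (xs : List A) → ∑ xs (λ _ → 0ℚ) ≡ 0ℚ
  ∑-zero []       = refl
  ∑-zero (x ∷ xs) = trans (ℚP.+-identityˡ _) (∑-zero xs)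

  ∑-distrib-+ : ∀ (xs : List A) f g → ∑ xs (λ x → f x + g x) ≡ ∑ xs f + ∑ xs g
  ∑-distrib-+ []       f g = refl
  ∑-distrib-+ (x ∷ xs) f g =
    trans (cong (f x + g x +_) (∑-distrib-+ xs f g)) (interchange (f x) (g x) (∑ xs f) (∑ xs g))
    where
    interchange : ∀ a b c d → (a + b) + (c + d) ≡ (a + c) + (b + d)
    interchange = solve-∀ ℚ-ring

  *-distribˡ-∑ : ∀ (xs : List A) a f → ∑ xs (λ x → a * f x) ≡ a * ∑ xs f
  *-distribˡ-∑ []       a f = sym (ℚP.*-zeroʳ a)
  *-distribˡ-∑ (x ∷ xs) a f =
    trans (cong (a * f x +_) (*-distribˡ-∑ xs a f)) (sym (ℚP.*-distribˡ-+ a (f x) (∑ xs f)))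

  ∑-swap : ∀ (xs : List A) (ys : List B) (f : A → B → ℚ) →
    ∑ xs (λ x → ∑ ys (f x)) ≡ ∑ ys (λ y → ∑ xs (λ x → f x y))
  ∑-swap []       ys f = sym (∑-zero ys)
  ∑-swap (x ∷ xs) ys f =
    trans (cong (∑ ys (f x) +_) (∑-swap xs ys f)) (sym (∑-distrib-+ ys (f x) _))

  ∑-map : ∀ (xs : List A) (h : A → B) (f : B → ℚ) → ∑ (map h xs) f ≡ ∑ xs (f ∘ h)
  ∑-map []       h f = refl
  ∑-map (x ∷ xs) h f = cong (f (h x) +_) (∑-map xs h f)

  ∑-↭ : ∀ {xs ys : List A} (f : A → ℚ) → xs ↭ ys → ∑ xs f ≡ ∑ ys f
  ∑-↭ f Perm.refl         = refl
  ∑-↭ f (Perm.prep x p)   = cong (f x +_) (∑-↭ f p)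
  ∑-↭ f (Perm.swap {xs} {ys} x y p) =
    trans (cong (λ s → f x + (f y + s)) (∑-↭ f p)) (left-comm (f x) (f y) (∑ ys f))
    where
    left-comm : ∀ a b c → a + (b + c) ≡ b + (a + c)
    left-comm = solve-∀ ℚ-ring
  ∑-↭ f (Perm.trans p q)  = trans (∑-↭ f p) (∑-↭ f q)

-- Linear independence of rows and fraction-free elimination.

module LinearIndependence where
  open ℚ using (ℚ; 0ℚ; 1ℚ; _+_; _*_; _-_; -_)
  open ≡-Reasoning
  open Sums

  private
    variable
      A B C : Set

  Stress : Set → Set
  Stress A = List (ℚ × A)

  total : (A → C → ℚ) → Stress A → C → ℚ
  total r W c = ∑ W (λ w → proj₁ w * r (proj₂ w) c)

  -- Coefficients are attached to list entries rather than given by a function on `A`, so a repeated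
  -- row, such as a parallel edge, gets its own coefficient. The columns form a list because later
  -- arguments discard some of them.
  LinIndep : List C → (A → C → ℚ) → List A → Set
  LinIndep cols r xs = ∀ W → map proj₂ W ≡ xs →
    (∀ {c} → c ∈ cols → total r W c ≡ 0ℚ) → All (λ w → proj₁ w ≡ 0ℚ) W

  private
    variable
      cols : List C
      r s : A → C → ℚ
      xs ys : List A

  total-cong : (∀ x c → r x c ≡ s x c) → ∀ W (c : C) → total {A} r W c ≡ total s W c
  total-cong r≗s W c = ∑-cong W λ w → cong (proj₁ w *_) (r≗s (proj₂ w) c)

  independent-cong : (∀ x c → r x c ≡ s x c) → LinIndep cols r xs → LinIndep cols s xs
  independent-cong r≗s indep W eq zero-total =
    indep W eq λ {c} c∈ → trans (total-cong r≗s W c) (zero-total c∈)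

  independent-↭ : ys ↭ xs → LinIndep cols r xs → LinIndep cols r ys
  independent-↭ {ys = ys} {xs = xs} ys↭xs indep W refl zero-total with ↭-map-inv proj₂ ys↭xs
  ... | W′ , refl , W↭W′ =
    All-resp-↭ (↭-sym W↭W′)
      (indep W′ refl λ c∈ → trans (sym (∑-↭ _ W↭W′)) (zero-total c∈))

  independent-tail : ∀ {x : A} → LinIndep cols r (x ∷ xs) → LinIndep cols r xs
  independent-tail {r = r} {x = x} indep W refl zero-total =
    All.tail (indep ((0ℚ , x) ∷ W) refl λ {c} c∈ → trans (zero-head (r x c) _) (zero-total c∈))
    where
    zero-head : ∀ a b → 0ℚ * a + b ≡ b
    zero-head = solve-∀ ℚ-ring

  independent-map⁻ : ∀ {f : A → B} → LinIndep cols r (map f xs) → LinIndep cols (r ∘ f) xs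
  independent-map⁻ {f = f} indep W refl zero-total =
    AllP.map⁻ (indep (map relabel W) (trans (sym (map-∘ W)) (map-∘ W))
      λ c∈ → trans (∑-map W relabel _) (zero-total c∈))
    where
    relabel = λ w → proj₁ w , f (proj₂ w)

  lift-stress : ∀ (f : A → B) xs (W : Stress B) → map proj₂ W ≡ map f xs →
    ∃ λ (W′ : Stress A) → map proj₂ W′ ≡ xs × W ≡ map (λ w → proj₁ w , f (proj₂ w)) W′
  lift-stress f []       []            eq = [] , refl , refl
  lift-stress f (x ∷ xs) ((q , y) ∷ W) eq
    with refl ← ∷-injectiveˡ eq | W′ , refl , refl ← lift-stress f xs W (∷-injectiveʳ eq) =
    (q , x) ∷ W′ , refl , refl

  independent-map⁺ : ∀ {f : A → B} → LinIndep cols (r ∘ f) xs → LinIndep cols r (map f xs)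
  independent-map⁺ {f = f} indep W eq zero-total with lift-stress f _ W eq
  ... | W′ , refl , refl =
    AllP.map⁺ (indep W′ refl λ c∈ → trans (sym (∑-map W′ _ _)) (zero-total c∈))

  -- Were the row of `x` zero on `cols`, weight 1 on `x` and 0 on the rest would be a nontrivial
  -- relation. The column found serves as a pivot.
  nonzero-column : ∀ {x : A} → LinIndep cols r (x ∷ xs) → ∃ λ c → c ∈ cols × r x c ≢ 0ℚ
  nonzero-column {cols = cols} {r = r} {xs = xs} {x = x} indep
    with Any.any? (λ c → ¬? (r x c ℚP.≟ 0ℚ)) cols
  ... | yes nonzero = find nonzero
  ... | no all-zero = ⊥-elim (ℚP.1≢0 (All.head (indep ((1ℚ , x) ∷ map (0ℚ ,_) xs)
          (cong (x ∷_) (trans (sym (map-∘ xs)) (map-id xs)))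
          (λ {c} c∈ → begin
            1ℚ * r x c + total r (map (0ℚ ,_) xs) c
              ≡⟨ cong₂ _+_ (trans (ℚP.*-identityˡ _) (row-zero c∈)) (∑-map xs (0ℚ ,_) _) ⟩
            0ℚ + ∑ xs (λ y → 0ℚ * r y c)
              ≡⟨ ℚP.+-identityˡ _ ⟩
            ∑ xs (λ y → 0ℚ * r y c)
              ≡⟨ ∑-cong xs (λ y → ℚP.*-zeroˡ (r y c)) ⟩
            ∑ xs (λ _ → 0ℚ)
              ≡⟨ ∑-zero xs ⟩
            0ℚ ∎))))
    where
    row-zero : ∀ {c} → c ∈ cols → r x c ≡ 0ℚ
    row-zero {c} c∈ = decidable-stable (r x c ℚP.≟ 0ℚ) (All.lookup (AllP.¬Any⇒All¬ _ all-zero) c∈)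

  -- One step of fraction-free Gaussian elimination, with pivot r x d: avoiding division
  -- keeps polynomial rows polynomial.
  eliminate : (A → C → ℚ) → A → C → A → C → ℚ
  eliminate r x d y c = r x d * r y c - r y d * r x c

  -- Elimination is linear in the row being changed, so it can be applied to a whole combination at
  -- once.
  total-eliminate : ∀ (r : A → C → ℚ) x d W c →
    total (eliminate r x d) W c ≡ r x d * total r W c - total r W d * r x c
  total-eliminate r x d [] c = base (r x d) (r x c)
    where
    base : ∀ p q → 0ℚ ≡ p * 0ℚ - 0ℚ * q
    base = solve-∀ ℚ-ring
  total-eliminate r x d ((q , y) ∷ W) c =
    trans (cong (q * eliminate r x d y c +_) (total-eliminate r x d W c))
      (step q (r x d) (r y c) (r y d) (r x c) (total r W c) (total r W d))
    where
    step : ∀ q p yc yd xc s t →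
      q * (p * yc - yd * xc) + (p * s - t * xc) ≡ p * (q * yc + s) - (q * yd + t) * xc
    step = solve-∀ ℚ-ring

  total-scale : ∀ (r : A → C → ℚ) a W c →
    total r (map (λ w → a * proj₁ w , proj₂ w) W) c ≡ a * total r W c
  total-scale r a W c = begin
    total r (map (λ w → a * proj₁ w , proj₂ w) W) c      ≡⟨ ∑-map W _ _ ⟩
    ∑ W (λ w → a * proj₁ w * r (proj₂ w) c)              ≡⟨ ∑-cong W (λ w → ℚP.*-assoc a _ _) ⟩
    ∑ W (λ w → a * (proj₁ w * r (proj₂ w) c))            ≡⟨ *-distribˡ-∑ W a _ ⟩
    a * total r W c                                      ∎

  -- A relation `W` among the eliminated rows lifts to the original ones: scale `W` by the pivot and
  -- give `x` the weight `- total r W d`. Cancelling the nonzero pivot then clears `W`.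
  eliminate-independent : ∀ {x : A} {d : C} → r x d ≢ 0ℚ →
    LinIndep cols r (x ∷ xs) → LinIndep cols (eliminate r x d) xs
  eliminate-independent {r = r} {x = x} {d = d} p≢0 indep W refl zero-total
    = All.map (*-nonzero-cancelˡ p≢0) (AllP.map⁻ (All.tail (indep ((- total r W d , x) ∷ map (λ w → r x d * proj₁ w , proj₂ w) W)
      (cong (x ∷_) (sym (map-∘ W)))
      (λ {c} c∈ → begin
        - total r W d * r x c + total r (map (λ w → r x d * proj₁ w , proj₂ w) W) c
          ≡⟨ cong (- total r W d * r x c +_) (total-scale r (r x d) W c) ⟩
        - total r W d * r x c + r x d * total r W c
          ≡⟨ rearrange (total r W d) (r x c) (r x d) (total r W c) ⟩
        r x d * total r W c - total r W d * r x c
          ≡⟨ total-eliminate r x d W c ⟨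
        total (eliminate r x d) W c
          ≡⟨ zero-total c∈ ⟩
        0ℚ ∎))))
    where
    rearrange : ∀ t xc p s → - t * xc + p * s ≡ p * s - t * xc
    rearrange = solve-∀ ℚ-ring

  -- The row `x` eliminates itself, so a relation with weight `q` on `x` restricts to a relation `W`
  -- among the eliminated rows. Hence `W` vanishes, and column `d` then forces `q` to vanish.
  eliminate-independent⁻ : ∀ {x : A} {d : C} → d ∈ cols → r x d ≢ 0ℚ →
    LinIndep cols (eliminate r x d) xs → LinIndep cols r (x ∷ xs)
  eliminate-independent⁻ {r = r} {x = x} {d = d} d∈ p≢0 indep ((q , x) ∷ W) refl zero-total =
    *-nonzero-cancelˡ p≢0 (begin
      r x d * q                              ≡⟨ tail-isolated (r x d) q (total r W d) ⟩
      (q * r x d + total r W d) - total r W d ≡⟨ cong₂ _-_ (zero-total d∈) (W-total d) ⟩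
      0ℚ                                     ∎)
    ∷ W-zero
    where
    tail-isolated : ∀ p q t → p * q ≡ (q * p + t) - t
    tail-isolated = solve-∀ ℚ-ring
    regroup : ∀ p s t xc q → p * s - t * xc ≡ p * (q * xc + s) - (q * p + t) * xc
    regroup = solve-∀ ℚ-ring
    vanish : ∀ p xc → p * 0ℚ - 0ℚ * xc ≡ 0ℚ
    vanish = solve-∀ ℚ-ring
    W-zero : All (λ w → proj₁ w ≡ 0ℚ) W
    W-zero = indep W refl λ {c} c∈ → begin
      total (eliminate r x d) W c
        ≡⟨ total-eliminate r x d W c ⟩
      r x d * total r W c - total r W d * r x c
        ≡⟨ regroup (r x d) (total r W c) (total r W d) (r x c) q ⟩
      r x d * (q * r x c + total r W c) - (q * r x d + total r W d) * r x c
        ≡⟨ cong₂ (λ u v → r x d * u - v * r x c) (zero-total c∈) (zero-total d∈) ⟩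
      r x d * 0ℚ - 0ℚ * r x c
        ≡⟨ vanish (r x d) (r x c) ⟩
      0ℚ ∎
    zero-weights : ∀ {V} → All (λ w → proj₁ w ≡ 0ℚ) V → ∀ c → total r V c ≡ 0ℚ
    zero-weights []                       c = refl
    zero-weights {(_ , y) ∷ V} (refl ∷ V-zero) c =
      cong₂ _+_ (ℚP.*-zeroˡ (r y c)) (zero-weights V-zero c)
    W-total : ∀ c → total r W c ≡ 0ℚ
    W-total = zero-weights W-zero

  -- After elimination with pivot column `d` all remaining rows vanish at `d`, so one row and one
  -- column can be discarded together.
  independent-length : ∀ (xs : List A) {cols : List C} {r} → LinIndep cols r xs → length xs ℕ.≤ length cols
  independent-length []       indep = ℕ.z≤n
  independent-length (x ∷ xs) {r = r} indep with nonzero-column indep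
  ... | d , d∈ , p≢0 with ∈-∃++ d∈
  ... | as , bs , refl =
    subst (suc (length xs) ℕ.≤_) (sym length-split) (ℕ.s≤s (independent-length xs remaining-indep))
    where
    length-split : length (as ++ d ∷ bs) ≡ suc (length (as ++ bs))
    length-split = begin
      length (as ++ d ∷ bs)            ≡⟨ length-++ as ⟩
      length as ℕ.+ suc (length bs)    ≡⟨ ℕP.+-suc (length as) (length bs) ⟩
      suc (length as ℕ.+ length bs)    ≡⟨ cong suc (length-++ as) ⟨
      suc (length (as ++ bs))          ∎
    pivot-cancels : ∀ p s → p * s - s * p ≡ 0ℚ
    pivot-cancels = solve-∀ ℚ-ring
    zero-at-pivot : ∀ W → total (eliminate r x d) W d ≡ 0ℚ
    zero-at-pivot W = trans (total-eliminate r x d W d) (pivot-cancels (r x d) (total r W d))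
    remaining-indep : LinIndep (as ++ bs) (eliminate r x d) xs
    remaining-indep W eq zero-total = eliminate-independent p≢0 indep W eq (extended ∘ ∈-++⁻ as)
      where
      extended : ∀ {c} → c ∈ as ⊎ c ∈ d ∷ bs → total (eliminate r x d) W c ≡ 0ℚ
      extended (inj₁ c∈)           = zero-total (∈-++⁺ˡ c∈)
      extended (inj₂ (here refl))  = zero-at-pivot W
      extended (inj₂ (there c∈))   = zero-total (∈-++⁺ʳ as c∈)

-- One-variable polynomial functions and generic parameters.

module Polynomials where
  open ℚ using (ℚ; 0ℚ; 1ℚ; _+_; _*_; _-_; -_)
  open ≡-Reasoning
  open Sums
  open LinearIndependence

  -- Coefficient-free polynomials: the factor theorem is the definition, so roots split off at once.
  -- DegreeBelow 0 contains only the zero function.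
  DegreeBelow : ℕ → (ℚ → ℚ) → Set
  DegreeBelow zero    f = ∀ x → f x ≡ 0ℚ
  DegreeBelow (suc d) f = ∀ a → Σ (ℚ → ℚ) λ q → DegreeBelow d q × (∀ x → f x ≡ f a + (x - a) * q x)

  record Polynomial (f : ℚ → ℚ) : Set where
    constructor _,_
    field
      bound       : ℕ
      degreeBelow : DegreeBelow bound f

  private
    variable
      d e : ℕ
      f g : ℚ → ℚ

  degree-suc : ∀ d {f} → DegreeBelow d f → DegreeBelow (suc d) f
  degree-suc zero {f} f≡0 a = (λ _ → 0ℚ) , (λ _ → refl) , λ x → begin
    f x                  ≡⟨ trans (f≡0 x) (sym (f≡0 a)) ⟩
    f a                  ≡⟨ no-slope (f a) (x - a) ⟩
    f a + (x - a) * 0ℚ   ∎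
    where
    no-slope : ∀ c y → c ≡ c + y * 0ℚ
    no-slope = solve-∀ ℚ-ring
  degree-suc (suc d) deg a with q , q-deg , f-eq ← deg a = q , degree-suc d q-deg , f-eq

  degree-+ : ∀ k → DegreeBelow d f → DegreeBelow (k ℕ.+ d) f
  degree-+ zero    deg = deg
  degree-+ (suc k) deg = degree-suc _ (degree-+ k deg)

  sum-degree : ∀ d {f g} → DegreeBelow d f → DegreeBelow d g → DegreeBelow d (λ x → f x + g x)
  sum-degree zero    f≡0 g≡0 x = cong₂ _+_ (f≡0 x) (g≡0 x)
  sum-degree (suc d) {f} {g} f-deg g-deg a
    with q , q-deg , f-eq ← f-deg a | s , s-deg , g-eq ← g-deg a =
    (λ x → q x + s x) , sum-degree d q-deg s-deg , λ x →
      trans (cong₂ _+_ (f-eq x) (g-eq x)) (collect (f a) (g a) (x - a) (q x) (s x))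
    where
    collect : ∀ u v y q s → (u + y * q) + (v + y * s) ≡ (u + v) + y * (q + s)
    collect = solve-∀ ℚ-ring

  scale-degree : ∀ d {f} b → DegreeBelow d f → DegreeBelow d (λ x → b * f x)
  scale-degree zero    b f≡0 x = trans (cong (b *_) (f≡0 x)) (ℚP.*-zeroʳ b)
  scale-degree (suc d) {f} b f-deg a with q , q-deg , f-eq ← f-deg a =
    (λ x → b * q x) , scale-degree d b q-deg , λ x →
      trans (cong (b *_) (f-eq x)) (distribute b (f a) (x - a) (q x))
    where
    distribute : ∀ b u y q → b * (u + y * q) ≡ b * u + y * (b * q)
    distribute = solve-∀ ℚ-ring

  zero-degree : ∀ d {f} → (∀ x → f x ≡ 0ℚ) → DegreeBelow d f
  zero-degree zero    f≡0 = f≡0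
  zero-degree (suc d) f≡0 = degree-suc d (zero-degree d f≡0)

  -- A discrete product rule gives the quotient at `a`. The bound `d + e` is not sharp, which is
  -- harmless: any finite bound will do.
  product-degree : ∀ d e {f g} → DegreeBelow d f → DegreeBelow e g → DegreeBelow (d ℕ.+ e) (λ x → f x * g x)
  product-degree zero e {g = g} f≡0 g-deg =
    zero-degree e λ x → trans (cong (_* g x) (f≡0 x)) (ℚP.*-zeroˡ (g x))
  product-degree (suc d) zero {f} f-deg g≡0 =
    zero-degree (suc d ℕ.+ zero) λ x → trans (cong (f x *_) (g≡0 x)) (ℚP.*-zeroʳ (f x))
  product-degree (suc d) (suc e) {f} {g} f-deg g-deg a
    with q , q-deg , f-eq ← f-deg a | s , s-deg , g-eq ← g-deg a =
    (λ x → q x * g x + f a * s x)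
    , sum-degree (d ℕ.+ suc e) (product-degree d (suc e) q-deg g-deg)
        (degree-+ d (degree-suc e (scale-degree e (f a) s-deg)))
    , λ x → begin
      f x * g x
        ≡⟨ expand (f x) (g x) (f a) (x - a) (q x) (f-eq x) ⟩
      f a * g x + (x - a) * (q x * g x)
        ≡⟨ cong (λ z → f a * z + (x - a) * (q x * g x)) (g-eq x) ⟩
      f a * (g a + (x - a) * s x) + (x - a) * (q x * g x)
        ≡⟨ collect (f a) (g a) (x - a) (s x) (q x * g x) ⟩
      f a * g a + (x - a) * (q x * g x + f a * s x) ∎
    where
    expand′ : ∀ u y q z → (u + y * q) * z ≡ u * z + y * (q * z)
    expand′ = solve-∀ ℚ-ring
    expand : ∀ fx gx u y q → fx ≡ u + y * q → fx * gx ≡ u * gx + y * (q * gx)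
    expand fx gx u y q eq = trans (cong (_* gx) eq) (expand′ u y q gx)
    collect : ∀ u v y s qz → u * (v + y * s) + y * qz ≡ u * v + y * (qz + u * s)
    collect = solve-∀ ℚ-ring

  constant : ∀ c → Polynomial (λ _ → c)
  constant c = 1 , λ a → (λ _ → 0ℚ) , (λ _ → refl) , λ x → no-slope c (x - a)
    where
    no-slope : ∀ c y → c ≡ c + y * 0ℚ
    no-slope = solve-∀ ℚ-ring

  identity : Polynomial id
  identity = 2 , λ a → (λ _ → 1ℚ) , Polynomial.degreeBelow (constant 1ℚ) , λ x → unit-slope x a
    where
    unit-slope : ∀ x a → x ≡ a + (x - a) * 1ℚ
    unit-slope = solve-∀ ℚ-ring

  infixl 6 _⊕_ _⊖_
  infixl 7 _⊗_

  _⊕_ : Polynomial f → Polynomial g → Polynomial (λ x → f x + g x)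
  _⊕_ {g = g} (d , f-deg) (e , g-deg) =
    e ℕ.+ d , sum-degree (e ℕ.+ d) (degree-+ e f-deg)
                (subst (λ k → DegreeBelow k g) (ℕP.+-comm d e) (degree-+ d g-deg))

  _⊗_ : Polynomial f → Polynomial g → Polynomial (λ x → f x * g x)
  (d , f-deg) ⊗ (e , g-deg) = d ℕ.+ e , product-degree d e f-deg g-deg

  degree-cong : ∀ d {f g} → (∀ x → f x ≡ g x) → DegreeBelow d f → DegreeBelow d g
  degree-cong zero    f≗g f≡0 x = trans (sym (f≗g x)) (f≡0 x)
  degree-cong (suc d) f≗g f-deg a with q , q-deg , f-eq ← f-deg a =
    q , q-deg , λ x → trans (sym (f≗g x)) (trans (f-eq x) (cong (_+ (x - a) * q x) (f≗g a)))

  polynomial-cong : (∀ x → f x ≡ g x) → Polynomial f → Polynomial g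
  polynomial-cong f≗g (d , f-deg) = d , degree-cong d f≗g f-deg

  _⊖_ : Polynomial f → Polynomial g → Polynomial (λ x → f x - g x)
  _⊖_ {f} {g} f-poly g-poly =
    polynomial-cong (λ x → subtract (f x) (g x)) (f-poly ⊕ constant (- 1ℚ) ⊗ g-poly)
    where
    subtract : ∀ u v → u + (- 1ℚ) * v ≡ u - v
    subtract = solve-∀ ℚ-ring

  if-polynomial : ∀ (b : Bool) → Polynomial f → Polynomial g → Polynomial (λ x → if b then f x else g x)
  if-polynomial true  f-poly g-poly = f-poly
  if-polynomial false f-poly g-poly = g-poly

  quotient-zero : ∀ {f q : ℚ → ℚ} a x → f x ≡ f a + (x - a) * q x → f a ≡ 0ℚ → f x ≡ (x - a) * q x
  quotient-zero {q = q} a x f-eq fa≡0 =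
    trans f-eq (trans (cong (_+ (x - a) * q x) fa≡0) (ℚP.+-identityˡ _))

  -- Each common zero t splits the factor x - t off f or off g.
  product-zero : ∀ d e {f g} → DegreeBelow d f → DegreeBelow e g →
    ∀ ts → Unique ts → length ts ≡ d ℕ.+ e → All (λ t → f t * g t ≡ 0ℚ) ts →
    (∀ x → f x ≡ 0ℚ) ⊎ (∀ x → g x ≡ 0ℚ)
  product-zero zero    e       f≡0 g-deg ts unique len zeros = inj₁ f≡0
  product-zero (suc d) zero    f-deg g≡0 ts unique len zeros = inj₂ g≡0
  product-zero (suc d) (suc e) {f} {g} f-deg g-deg (t ∷ ts) (t∉ts ∷ unique) len (tz ∷ zeros)
    with q , q-deg , f-eq ← f-deg t | s , s-deg , g-eq ← g-deg t | f t ℚP.≟ 0ℚ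
  ... | yes ft≡0 = result (product-zero d (suc e) q-deg g-deg ts unique (ℕP.suc-injective len) (reduce t∉ts zeros))
    where
    f-factor : ∀ x → f x ≡ (x - t) * q x
    f-factor x = quotient-zero {f} {q} t x (f-eq x) ft≡0
    reduce : ∀ {us} → All (t ≢_) us → All (λ u → f u * g u ≡ 0ℚ) us → All (λ u → q u * g u ≡ 0ℚ) us
    reduce []           []       = []
    reduce {u ∷ us} (t≢u ∷ rest) (z ∷ zs) =
      *-nonzero-cancelˡ (difference-≢0 (t≢u ∘ sym))
        (trans (sym (ℚP.*-assoc (u - t) (q u) (g u))) (trans (cong (_* g u) (sym (f-factor u))) z))
      ∷ reduce rest zs
    result : (∀ x → q x ≡ 0ℚ) ⊎ (∀ x → g x ≡ 0ℚ) → (∀ x → f x ≡ 0ℚ) ⊎ (∀ x → g x ≡ 0ℚ)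
    result (inj₁ q≡0) = inj₁ λ x → trans (f-factor x) (trans (cong ((x - t) *_) (q≡0 x)) (ℚP.*-zeroʳ (x - t)))
    result (inj₂ g≡0) = inj₂ g≡0
  ... | no  ft≢0 = result (product-zero (suc d) e f-deg s-deg ts unique
          (ℕP.suc-injective (trans len (cong suc (ℕP.+-suc d e)))) (reduce t∉ts zeros))
    where
    g-factor : ∀ x → g x ≡ (x - t) * s x
    g-factor x = quotient-zero {g} {s} t x (g-eq x) (*-nonzero-cancelˡ ft≢0 tz)
    shuffle : ∀ y u v → y * (u * v) ≡ u * (y * v)
    shuffle = solve-∀ ℚ-ring
    reduce : ∀ {us} → All (t ≢_) us → All (λ u → f u * g u ≡ 0ℚ) us → All (λ u → f u * s u ≡ 0ℚ) us
    reduce []           []       = []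
    reduce {u ∷ us} (t≢u ∷ rest) (z ∷ zs) =
      *-nonzero-cancelˡ (difference-≢0 (t≢u ∘ sym))
        (trans (shuffle (u - t) (f u) (s u)) (trans (cong (f u *_) (sym (g-factor u))) z))
      ∷ reduce rest zs
    result : (∀ x → f x ≡ 0ℚ) ⊎ (∀ x → s x ≡ 0ℚ) → (∀ x → f x ≡ 0ℚ) ⊎ (∀ x → g x ≡ 0ℚ)
    result (inj₁ f≡0) = inj₁ f≡0
    result (inj₂ s≡0) = inj₂ λ x → trans (g-factor x) (trans (cong ((x - t) *_) (s≡0 x)) (ℚP.*-zeroʳ (x - t)))

  -- Built with denominator 1 in place, so that injectivity can be read off the numerator. The
  -- naturals are the supply of distinct test points.
  fromℕ : ℕ → ℚ
  fromℕ i = ℚ.mkℚ (ℤ.+ i) 0 (Coprime.sym (Coprime.1-coprimeTo i))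

  fromℕ-injective : ∀ {i j} → fromℕ i ≡ fromℕ j → i ≡ j
  fromℕ-injective eq = ℤP.+-injective (cong ℚ.numerator eq)

  -- If the product vanished at `d + e` distinct points, `product-zero` would make one factor
  -- identically zero, against its value at `a` or `b`. So a search among the first `d + e` naturals
  -- succeeds.
  common-nonzero : ∀ {a b} → Polynomial f → Polynomial g → f a ≢ 0ℚ → g b ≢ 0ℚ →
    ∃ λ t → f t ≢ 0ℚ × g t ≢ 0ℚ
  common-nonzero {f} {g} {a} {b} (d , f-deg) (e , g-deg) fa≢0 gb≢0
    with All.all? (λ t → f t * g t ℚP.≟ 0ℚ) (map fromℕ (upTo (d ℕ.+ e)))
  ... | yes zeros = ⊥-elim (impossible (product-zero d e f-deg g-deg _
          (UniqueP.map⁺ fromℕ-injective (UniqueP.upTo⁺ (d ℕ.+ e)))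
          (trans (length-map fromℕ (upTo (d ℕ.+ e))) (length-upTo (d ℕ.+ e))) zeros))
    where
    impossible : ¬ ((∀ x → f x ≡ 0ℚ) ⊎ (∀ x → g x ≡ 0ℚ))
    impossible (inj₁ f≡0) = fa≢0 (f≡0 a)
    impossible (inj₂ g≡0) = gb≢0 (g≡0 b)
  ... | no ¬zeros
    with t , ft*gt≢0 ← Any.satisfied (AllP.¬All⇒Any¬ (λ t → f t * g t ℚP.≟ 0ℚ) _ ¬zeros) =
    t , factorˡ-≢0 ft*gt≢0 , factorʳ-≢0 {f t} ft*gt≢0

  private
    variable
      A C : Set

  -- `f` is the product of the pivots found at `t₀`. As the elimination is free of division, each
  -- pivot is a polynomial in `t`; wherever none of them vanishes, the same pivot columns certify
  -- independence by `eliminate-independent⁻`.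
  independent-generically : ∀ (xs : List A) {cols : List C} (r : ℚ → A → C → ℚ) →
    (∀ x c → Polynomial (λ t → r t x c)) → ∀ {t₀} → LinIndep cols (r t₀) xs →
    ∃ λ f → Polynomial f × f t₀ ≢ 0ℚ × (∀ t → f t ≢ 0ℚ → LinIndep cols (r t) xs)
  independent-generically [] r r-poly indep =
    (λ _ → 1ℚ) , constant 1ℚ , (λ ()) , λ { t _ [] refl _ → [] }
  independent-generically (x ∷ xs) r r-poly {t₀} indep =
    let d , d∈ , p≢0 = nonzero-column {r = r t₀} indep
        f , f-poly , ft₀≢0 , f-indep = independent-generically xs (λ t → eliminate (r t) x d)
          (λ y c → _⊖_ {λ t → r t x d * r t y c} {λ t → r t y d * r t x c}
            (r-poly x d ⊗ r-poly y c) (r-poly y d ⊗ r-poly x c))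
          {t₀} (eliminate-independent {r = r t₀} {x = x} {d = d} p≢0 indep)
    in (λ t → r t x d * f t) , r-poly x d ⊗ f-poly , *-≢0 {r t₀ x d} {f t₀} p≢0 ft₀≢0 , λ t pf≢0 →
         eliminate-independent⁻ {r = r t} {x = x} {d = d} d∈
           (factorˡ-≢0 {r t x d} {f t} pf≢0) (f-indep t (factorʳ-≢0 {r t x d} {f t} pf≢0))

  perturb : ∀ {xs : List A} {cols : List C} (r : ℚ → A → C → ℚ) →
    (∀ x c → Polynomial (λ t → r t x c)) → ∀ {a b} → LinIndep cols (r a) xs →
    Polynomial g → g b ≢ 0ℚ → ∃ λ t → LinIndep cols (r t) xs × g t ≢ 0ℚ
  perturb {xs = xs} r r-poly {a} indep g-poly gb≢0 =
    let f , f-poly , fa≢0 , f-indep = independent-generically xs r r-poly {a} indep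
        t , ft≢0 , gt≢0 = common-nonzero f-poly g-poly fa≢0 gb≢0
    in t , f-indep t ft≢0 , gt≢0

-- Subsets as lists of their elements.

module Selection where
  open import Data.Vec.Base using ([]; _∷_; here; there)

  select : ∀ {n} → Subset n → List (Fin n)
  select []          = []
  select (true  ∷ S) = zero ∷ map suc (select S)
  select (false ∷ S) = map suc (select S)

  length-select : ∀ {n} (S : Subset n) → length (select S) ≡ ∣ S ∣
  length-select []          = refl
  length-select (true  ∷ S) = cong suc (trans (length-map suc (select S)) (length-select S))
  length-select (false ∷ S) = trans (length-map suc (select S)) (length-select S)

  ∈-select⁺ : ∀ {n} {S : Subset n} {x} → x Sub.∈ S → x ∈ select S
  ∈-select⁺ {S = true  ∷ S} here       = here refl
  ∈-select⁺ {S = true  ∷ S} (there x∈) = there (∈-map⁺ suc (∈-select⁺ x∈))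
  ∈-select⁺ {S = false ∷ S} (there x∈) = ∈-map⁺ suc (∈-select⁺ x∈)

  ∈-select⁻ : ∀ {n} {S : Subset n} {x} → x ∈ select S → x Sub.∈ S
  ∈-select⁻ {S = true  ∷ S} (here refl) = here
  ∈-select⁻ {S = true  ∷ S} (there x∈) with _ , y∈ , refl ← ∈-map⁻ suc x∈ = there (∈-select⁻ y∈)
  ∈-select⁻ {S = false ∷ S} x∈ with _ , y∈ , refl ← ∈-map⁻ suc x∈ = there (∈-select⁻ y∈)

  split-↭ : ∀ {A : Set} (f : A → Bool) xs → xs ↭ filterᵇ f xs ++ filterᵇ (not ∘ f) xs
  split-↭ f [] = Perm.refl
  split-↭ f (x ∷ xs) with f x
  ... | true  = Perm.prep x (split-↭ f xs)
  ... | false = Perm.trans (Perm.prep x (split-↭ f xs)) (↭-sym (PermP.shift x _ _))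

-- The rigidity matrix and the necessity of Laman's condition.

module Rigidity where
  open ℚ using (ℚ; 0ℚ; 1ℚ; _+_; _*_; _-_; -_)
  open ≡-Reasoning
  open Sums
  open LinearIndependence
  open Selection

  Edge : ℕ → Set
  Edge n = Fin n × Fin n

  Column : ℕ → Set
  Column n = Fin n × Fin 2

  Placement* : ℕ → Set
  Placement* n = Fin n → Fin 2 → ℚ

  private
    variable
      n : ℕ

  at : Fin n → Fin n → ℚ → ℚ
  at a w q = if does (w FinP.≟ a) then q else 0ℚ

  -- Written in the shape of `entry`, so that the rows of G* coincide with these by computation.
  row : Placement* n → Edge n → Column n → ℚ
  row p (a , b) (w , c) = at a w (p a c - p b c) + at b w (p b c - p a c)

  coordinates : List (Fin n) → List (Column n)
  coordinates ws = cartesianProduct ws (allFin 2)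

  length-coordinates : ∀ (ws : List (Fin n)) → length (coordinates ws) ≡ length ws ℕ.* 2
  length-coordinates []       = refl
  length-coordinates (w ∷ ws) = cong (2 ℕ.+_) (length-coordinates ws)

  columns : List (Column n)
  columns = coordinates (allFin _)

  ∈-columns : ∀ (c : Column n) → c ∈ columns
  ∈-columns (w , c) = ∈-cartesianProduct⁺ (∈-allFin w) (∈-allFin c)

  StressFree : Placement* n → List (Edge n) → Set
  StressFree p = LinIndep columns (row p)

  edgeInside : Subset n → Edge n → Bool
  edgeInside X (a , b) = Vec.lookup X a ∧ Vec.lookup X b

  bit : Bool → ℕ
  bit b = if b then 1 else 0

  induced : Subset n → List (Edge n) → ℕ
  induced X []      = 0
  induced X (e ∷ E) = bit (edgeInside X e) ℕ.+ induced X E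

  -- The premise of an induced edge exempts vertex sets with at most one vertex, where 2|X| - 3 is
  -- negative. Being a record, the condition lets `E` be inferred from its type, which the unfolded
  -- inequalities would not.
  record Laman (E : List (Edge n)) : Set where
    constructor sparse
    field
      bound : ∀ X → 1 ℕ.≤ induced X E → induced X E ℕ.+ 3 ℕ.≤ 2 ℕ.* ∣ X ∣

  at-≡ : ∀ (a : Fin n) q → at a a q ≡ q
  at-≡ a q rewrite dec-true (a FinP.≟ a) refl = refl

  at-≢ : ∀ {a w : Fin n} q → w ≢ a → at a w q ≡ 0ℚ
  at-≢ {a = a} {w} q w≢a rewrite dec-false (w FinP.≟ a) w≢a = refl

  at-zero : ∀ (a w : Fin n) → at a w 0ℚ ≡ 0ℚ
  at-zero a w with does (w FinP.≟ a)
  ... | true  = refl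
  ... | false = refl

  row-outside : ∀ (p : Placement* n) {a b w} c → w ≢ a → w ≢ b → row p (a , b) (w , c) ≡ 0ℚ
  row-outside p c w≢a w≢b = cong₂ _+_ (at-≢ _ w≢a) (at-≢ _ w≢b)

  row-degenerate : ∀ (p : Placement* n) {a b} w {c} → p a c ≡ p b c → row p (a , b) (w , c) ≡ 0ℚ
  row-degenerate p {a} {b} w {c} eq = cong₂ _+_
    (trans (cong (at a w) (trans (cong (_- p b c) eq) (ℚP.+-inverseʳ (p b c)))) (at-zero a w))
    (trans (cong (at b w) (trans (cong (λ q → p b c - q) eq) (ℚP.+-inverseʳ (p b c)))) (at-zero b w))

  ∑-at : ∀ (g : Fin n → ℚ) a q → ∑ (allFin n) (λ w → g w * at a w q) ≡ g a * q
  ∑-at {n} g a q = present (UniqueP.allFin⁺ n) (∈-allFin a)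
    where
    absent : ∀ {xs} → All (a ≢_) xs → ∑ xs (λ w → g w * at a w q) ≡ 0ℚ
    absent []                       = refl
    absent {x ∷ xs} (a≢x ∷ a∉xs) =
      cong₂ _+_ (trans (cong (g x *_) (at-≢ q (a≢x ∘ sym))) (ℚP.*-zeroʳ (g x))) (absent a∉xs)
    present : ∀ {xs} → Unique xs → a ∈ xs → ∑ xs (λ w → g w * at a w q) ≡ g a * q
    present (a∉xs ∷ _) (here refl) =
      trans (cong₂ _+_ (cong (g a *_) (at-≡ a q)) (absent a∉xs)) (ℚP.+-identityʳ _)
    present {x ∷ xs} (x∉xs ∷ unique) (there a∈xs) =
      trans (cong₂ _+_ (trans (cong (g x *_) (at-≢ q (All.lookup x∉xs a∈xs))) (ℚP.*-zeroʳ (g x)))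
                       (present unique a∈xs))
            (ℚP.+-identityˡ _)

  edgeMoment : Placement* n → (Fin n → ℚ) → Fin 2 → Edge n → ℚ
  edgeMoment p g c (a , b) = g a * (p a c - p b c) + g b * (p b c - p a c)

  -- Pairs the resultants of a stress with vertex weights `g` and exchanges the sums, so that the
  -- pairing can be evaluated edge by edge. Constant `g` gives balance of forces, a coordinate as
  -- `g` gives balance of torque.
  moment : ∀ (p : Placement* n) (g : Fin n → ℚ) c W →
    ∑ (allFin n) (λ w → g w * total (row p) W (w , c)) ≡ ∑ W (λ v → proj₁ v * edgeMoment p g c (proj₂ v))
  moment {n} p g c W = begin
    ∑ (allFin n) (λ w → g w * ∑ W (λ v → proj₁ v * row p (proj₂ v) (w , c)))
      ≡⟨ ∑-cong (allFin n) (λ w → trans (sym (*-distribˡ-∑ W (g w) _))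
           (∑-cong W (λ v → left-comm (g w) (proj₁ v) _))) ⟩
    ∑ (allFin n) (λ w → ∑ W (λ v → proj₁ v * (g w * row p (proj₂ v) (w , c))))
      ≡⟨ ∑-swap (allFin n) W _ ⟩
    ∑ W (λ v → ∑ (allFin n) (λ w → proj₁ v * (g w * row p (proj₂ v) (w , c))))
      ≡⟨ ∑-cong W (λ v → *-distribˡ-∑ (allFin n) (proj₁ v) _) ⟩
    ∑ W (λ v → proj₁ v * ∑ (allFin n) (λ w → g w * row p (proj₂ v) (w , c)))
      ≡⟨ ∑-cong W (λ v → cong (proj₁ v *_) (edge (proj₂ v))) ⟩
    ∑ W (λ v → proj₁ v * edgeMoment p g c (proj₂ v)) ∎
    where
    left-comm : ∀ x y z → x * (y * z) ≡ y * (x * z)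
    left-comm = solve-∀ ℚ-ring
    edge : ∀ e → ∑ (allFin n) (λ w → g w * row p e (w , c)) ≡ edgeMoment p g c e
    edge (a , b) = begin
      ∑ (allFin n) (λ w → g w * row p (a , b) (w , c))
        ≡⟨ ∑-cong (allFin n) (λ w → ℚP.*-distribˡ-+ (g w) _ _) ⟩
      ∑ (allFin n) (λ w → g w * at a w _ + g w * at b w _)
        ≡⟨ ∑-distrib-+ (allFin n) _ _ ⟩
      ∑ (allFin n) (λ w → g w * at a w _) + ∑ (allFin n) (λ w → g w * at b w _)
        ≡⟨ cong₂ _+_ (∑-at g a _) (∑-at g b _) ⟩
      edgeMoment p g c (a , b) ∎

  translation : ∀ (p : Placement* n) c W → ∑ (allFin n) (λ w → 1ℚ * total (row p) W (w , c)) ≡ 0ℚ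
  translation p c W = trans (moment p (λ _ → 1ℚ) c W)
    (trans (∑-cong W λ v → balanced (proj₁ v) (p (proj₁ (proj₂ v)) c) (p (proj₂ (proj₂ v)) c)) (∑-zero W))
    where
    balanced : ∀ q x y → q * (1ℚ * (x - y) + 1ℚ * (y - x)) ≡ 0ℚ
    balanced = solve-∀ ℚ-ring

  -- The force of an edge is parallel to the edge and has no torque: for each edge both sides are
  -- its coefficient times the product of its two coordinate differences.
  rotation : ∀ (p : Placement* n) c d W →
    ∑ (allFin n) (λ w → p w d * total (row p) W (w , c)) ≡ ∑ (allFin n) (λ w → p w c * total (row p) W (w , d))
  rotation p c d W = trans (moment p (λ w → p w d) c W)
    (trans (∑-cong W λ v → cong (proj₁ v *_) (balanced (p (proj₁ (proj₂ v)) c) (p (proj₁ (proj₂ v)) d)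
             (p (proj₂ (proj₂ v)) c) (p (proj₂ (proj₂ v)) d)))
      (sym (moment p (λ w → p w c) d W)))
    where
    balanced : ∀ x x′ y y′ → x′ * (x - y) + y′ * (y - x) ≡ x * (x′ - y′) + y * (y′ - x′)
    balanced = solve-∀ ℚ-ring

  ∑-two : ∀ (g f : Fin n → ℚ) {a b} → a ≢ b → (∀ {w} → w ≢ a → w ≢ b → f w ≡ 0ℚ) →
    ∑ (allFin n) (λ w → g w * f w) ≡ g a * f a + g b * f b
  ∑-two {n} g f {a} {b} a≢b f-zero = begin
    ∑ (allFin n) (λ w → g w * f w)
      ≡⟨ ∑-cong (allFin n) (λ w → trans (cong (g w *_) (split w)) (ℚP.*-distribˡ-+ (g w) _ _)) ⟩
    ∑ (allFin n) (λ w → g w * at a w (f a) + g w * at b w (f b))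
      ≡⟨ ∑-distrib-+ (allFin n) _ _ ⟩
    ∑ (allFin n) (λ w → g w * at a w (f a)) + ∑ (allFin n) (λ w → g w * at b w (f b))
      ≡⟨ cong₂ _+_ (∑-at g a (f a)) (∑-at g b (f b)) ⟩
    g a * f a + g b * f b ∎
    where
    split : ∀ w → f w ≡ at a w (f a) + at b w (f b)
    split w with w FinP.≟ a | w FinP.≟ b
    ... | yes refl | yes refl = ⊥-elim (a≢b refl)
    ... | yes refl | no _     = sym (ℚP.+-identityʳ (f w))
    ... | no _     | yes refl = sym (ℚP.+-identityˡ (f w))
    ... | no w≢a   | no w≢b   = f-zero w≢a w≢b

  -- A stress whose resultant is supported on a and b has opposite resultants at a and b, and
  -- no torque; so one coordinate not constant on the line a b determines the resultants.
  resultant-zero : ∀ (p : Placement* n) W {a b c} → p a c ≢ p b c →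
    (∀ {w} d → w ≢ a → w ≢ b → total (row p) W (w , d) ≡ 0ℚ) →
    total (row p) W (b , c) ≡ 0ℚ → ∀ w d → total (row p) W (w , d) ≡ 0ℚ
  resultant-zero {n} p W {a} {b} {c} pa≢pb elsewhere sbc≡0 = everywhere
    where
    s : Fin n → Fin 2 → ℚ
    s w d = total (row p) W (w , d)
    a≢b : a ≢ b
    a≢b refl = pa≢pb refl
    opposite : ∀ d → 1ℚ * s a d + 1ℚ * s b d ≡ 0ℚ
    opposite d = trans (sym (∑-two (λ _ → 1ℚ) (λ w → s w d) a≢b (elsewhere d))) (translation p d W)
    torque : ∀ d → p a d * s a c + p b d * s b c ≡ p a c * s a d + p b c * s b d
    torque d = trans (sym (∑-two (λ w → p w d) (λ w → s w c) a≢b (elsewhere c)))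
      (trans (rotation p c d W) (∑-two (λ w → p w c) (λ w → s w d) a≢b (elsewhere d)))
    isolate : ∀ x y → x ≡ (1ℚ * x + 1ℚ * y) - y
    isolate = solve-∀ ℚ-ring
    sac≡0 : s a c ≡ 0ℚ
    sac≡0 = trans (isolate (s a c) (s b c)) (cong₂ _-_ (opposite c) sbc≡0)
    eliminate-a : ∀ x y u v → (x - y) * v ≡ x * (1ℚ * u + 1ℚ * v) - (x * u + y * v)
    eliminate-a = solve-∀ ℚ-ring
    vanish : ∀ x y z → x * 0ℚ - (y * 0ℚ + z * 0ℚ) ≡ 0ℚ
    vanish = solve-∀ ℚ-ring
    sb≡0 : ∀ d → s b d ≡ 0ℚ
    sb≡0 d = *-nonzero-cancelˡ (difference-≢0 pa≢pb) (begin
      (p a c - p b c) * s b d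
        ≡⟨ eliminate-a (p a c) (p b c) (s a d) (s b d) ⟩
      p a c * (1ℚ * s a d + 1ℚ * s b d) - (p a c * s a d + p b c * s b d)
        ≡⟨ cong₂ (λ u v → p a c * u - v) (opposite d) (sym (torque d)) ⟩
      p a c * 0ℚ - (p a d * s a c + p b d * s b c)
        ≡⟨ cong₂ (λ u v → p a c * 0ℚ - (p a d * u + p b d * v)) sac≡0 sbc≡0 ⟩
      p a c * 0ℚ - (p a d * 0ℚ + p b d * 0ℚ)
        ≡⟨ vanish (p a c) (p a d) (p b d) ⟩
      0ℚ ∎)
    sa≡0 : ∀ d → s a d ≡ 0ℚ
    sa≡0 d = trans (isolate (s a d) (s b d)) (cong₂ _-_ (opposite d) (sb≡0 d))
    everywhere : ∀ w d → s w d ≡ 0ℚ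
    everywhere w d with w FinP.≟ a | w FinP.≟ b
    ... | yes refl | _        = sa≡0 d
    ... | no _     | yes refl = sb≡0 d
    ... | no w≢a   | no w≢b   = elsewhere d w≢a w≢b

  Spanned : Subset n → List (Edge n) → Set
  Spanned X = All λ (a , b) → a Sub.∈ X × b Sub.∈ X

  total-outside : ∀ (p : Placement* n) {X} W → Spanned X (map proj₂ W) →
    ∀ {w} c → w Sub.∉ X → total (row p) W (w , c) ≡ 0ℚ
  total-outside p []            []                    c w∉X = refl
  total-outside p ((q , a , b) ∷ W) ((a∈X , b∈X) ∷ spanned) {w} c w∉X = cong₂ _+_
    (trans (cong (q *_) (row-outside p {a} {b} {w} c (λ { refl → w∉X a∈X }) (λ { refl → w∉X b∈X }))) (ℚP.*-zeroʳ q))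
    (total-outside p W spanned c w∉X)

  stressFree-bound : ∀ (p : Placement* n) {X} E → 1 ℕ.≤ length E → Spanned X E → StressFree p E →
    length E ℕ.+ 3 ℕ.≤ 2 ℕ.* ∣ X ∣
  stressFree-bound {n} p {X} ((a , b) ∷ E) _ spanned@((a∈X , b∈X) ∷ _) stress-free =
    bound (nonzero-column {r = row p} stress-free)
    where
    bound : ∃ (λ c → c ∈ columns × row p (a , b) c ≢ 0ℚ) → suc (length E) ℕ.+ 3 ℕ.≤ 2 ℕ.* ∣ X ∣
    bound ((w , c) , _ , row≢0) =
      ℕP.≤-trans (ℕP.+-monoˡ-≤ 3 (independent-length _ reduced))
        (ℕP.≤-trans (ℕP.≤-reflexive (trans (cong (λ k → suc k ℕ.+ 3) coordinates-length) (double ∣ X Sub.- a Sub.- b ∣)))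
          (ℕP.*-monoʳ-≤ 2 (ℕP.≤-trans (ℕ.s≤s (SubP.x∈p⇒∣p-x∣<∣p∣ b∈X-a)) (SubP.x∈p⇒∣p-x∣<∣p∣ a∈X))))
      where
      double : ∀ k → suc (k ℕ.* 2) ℕ.+ 3 ≡ 2 ℕ.* suc (suc k)
      double = ℕSolver.solve-∀
      pa≢pb : p a c ≢ p b c
      pa≢pb eq = row≢0 (row-degenerate p w eq)
      b∈X-a : b Sub.∈ X Sub.- a
      b∈X-a = SubP.x∈p∧x≢y⇒x∈p-y b∈X λ { refl → pa≢pb refl }
      rest : List (Fin n)
      rest = select (X Sub.- a Sub.- b)
      coordinates-length : length (coordinates rest) ≡ ∣ X Sub.- a Sub.- b ∣ ℕ.* 2
      coordinates-length = trans (length-coordinates rest) (cong (ℕ._* 2) (length-select (X Sub.- a Sub.- b)))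
      reduced : LinIndep ((b , c) ∷ coordinates rest) (row p) ((a , b) ∷ E)
      reduced W eq zero-total = stress-free W eq λ {v} _ →
        resultant-zero p W pa≢pb elsewhere (zero-total (here refl)) (proj₁ v) (proj₂ v)
        where
        elsewhere : ∀ {w} d → w ≢ a → w ≢ b → total (row p) W (w , d) ≡ 0ℚ
        elsewhere {w} d w≢a w≢b with w SubP.∈? X
        ... | yes w∈X = zero-total (there (∈-cartesianProduct⁺
                (∈-select⁺ (SubP.x∈p∧x≢y⇒x∈p-y (SubP.x∈p∧x≢y⇒x∈p-y w∈X w≢a) w≢b)) (∈-allFin d)))
        ... | no w∉X  = total-outside p W (subst (Spanned X) (sym eq) spanned) d w∉X

  independent-++ʳ : ∀ {A C : Set} {cols : List C} {r : A → C → ℚ} xs {ys} →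
    LinIndep cols r (xs ++ ys) → LinIndep cols r ys
  independent-++ʳ []       indep = indep
  independent-++ʳ {r = r} (x ∷ xs) indep = independent-++ʳ {r = r} xs (independent-tail {r = r} indep)

  inside⇒∈ : ∀ {X : Subset n} {a b} → edgeInside X (a , b) ≡ true → a Sub.∈ X × b Sub.∈ X
  inside⇒∈ {X = X} {a} {b} eq with Vec.lookup X a in a-eq | Vec.lookup X b in b-eq
  ... | true | true = VecP.lookup⇒[]= a X a-eq , VecP.lookup⇒[]= b X b-eq

  ∈⇒inside : ∀ {X : Subset n} {a b} → a Sub.∈ X → b Sub.∈ X → edgeInside X (a , b) ≡ true
  ∈⇒inside a∈X b∈X = cong₂ _∧_ (VecP.[]=⇒lookup a∈X) (VecP.[]=⇒lookup b∈X)

  filter-inside : ∀ (X : Subset n) E →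
    Spanned X (filterᵇ (edgeInside X) E) × length (filterᵇ (edgeInside X) E) ≡ induced X E
  filter-inside X [] = [] , refl
  filter-inside X (e ∷ E) with edgeInside X e in eq | filter-inside X E
  ... | true  | spanned , len = inside⇒∈ eq ∷ spanned , cong suc len
  ... | false | spanned , len = spanned , len

  -- The edges inside `X` are permuted to the end of the list; dropping those before them keeps
  -- independence.
  stressFree⇒Laman : ∀ (p : Placement* n) E → StressFree p E → Laman E
  stressFree⇒Laman {n} p E stress-free = sparse bounded
    where
    bounded : ∀ X → 1 ℕ.≤ induced X E → induced X E ℕ.+ 3 ℕ.≤ 2 ℕ.* ∣ X ∣
    bounded X nonempty with spanned , len ← filter-inside X E =
      subst (λ k → k ℕ.+ 3 ℕ.≤ 2 ℕ.* ∣ X ∣) len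
        (stressFree-bound p (filterᵇ (edgeInside X) E) (subst (1 ℕ.≤_) (sym len) nonempty) spanned
          (independent-++ʳ {r = row p} (filterᵇ (not ∘ edgeInside X) E)
            (independent-↭ {r = row p}
              (Perm.trans (PermP.++-comm (filterᵇ (not ∘ edgeInside X) E) _) (↭-sym (split-↭ (edgeInside X) E)))
              stress-free)))

-- Sparsity counts, tight sets and vertices of low degree.

module Sparsity where
  open import Data.Nat.Base using (_+_; _*_; _≤_; _<_; z≤n; s≤s)
  open Selection
  open Rigidity
  open Laman

  private
    variable
      n : ℕ

  ∣∪∣+∣∩∣ : ∀ (X Y : Subset n) → ∣ X ∪ Y ∣ + ∣ X ∩ Y ∣ ≡ ∣ X ∣ + ∣ Y ∣
  ∣∪∣+∣∩∣ Vec.[]              Vec.[]              = refl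
  ∣∪∣+∣∩∣ (false Vec.∷ X) (false Vec.∷ Y) = ∣∪∣+∣∩∣ X Y
  ∣∪∣+∣∩∣ (true  Vec.∷ X) (false Vec.∷ Y) = cong suc (∣∪∣+∣∩∣ X Y)
  ∣∪∣+∣∩∣ (false Vec.∷ X) (true  Vec.∷ Y) =
    trans (cong suc (∣∪∣+∣∩∣ X Y)) (sym (ℕP.+-suc (∣ X ∣) (∣ Y ∣)))
  ∣∪∣+∣∩∣ (true  Vec.∷ X) (true  Vec.∷ Y) =
    cong suc (trans (ℕP.+-suc _ _) (trans (cong suc (∣∪∣+∣∩∣ X Y)) (sym (ℕP.+-suc (∣ X ∣) (∣ Y ∣)))))

  ∣∪∣≤ : ∀ (X Y : Subset n) → ∣ X ∪ Y ∣ ≤ ∣ X ∣ + ∣ Y ∣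
  ∣∪∣≤ X Y = ℕP.≤-trans (ℕP.m≤m+n _ _) (ℕP.≤-reflexive (∣∪∣+∣∩∣ X Y))

  1≤∣∣ : ∀ {X : Subset n} {a} → a Sub.∈ X → 1 ≤ ∣ X ∣
  1≤∣∣ a∈X = ℕP.≤-trans (s≤s z≤n) (SubP.x∈p⇒∣p-x∣<∣p∣ a∈X)

  2≤∣∣ : ∀ {X : Subset n} {a b} → a Sub.∈ X → b Sub.∈ X → a ≢ b → 2 ≤ ∣ X ∣
  2≤∣∣ a∈X b∈X a≢b =
    ℕP.≤-trans (s≤s (1≤∣∣ (SubP.x∈p∧x≢y⇒x∈p-y b∈X (a≢b ∘ sym)))) (SubP.x∈p⇒∣p-x∣<∣p∣ a∈X)

  inside-mono : ∀ (X {Y} : Subset n) e → X ⊆ Y → edgeInside X e ≡ true → edgeInside Y e ≡ true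
  inside-mono X (a , b) X⊆Y eq with a∈X , b∈X ← inside⇒∈ {X = X} {a} {b} eq = ∈⇒inside (X⊆Y a∈X) (X⊆Y b∈X)

  inside-∩ : ∀ (X Y : Subset n) e → edgeInside X e ≡ true → edgeInside Y e ≡ true → edgeInside (X ∩ Y) e ≡ true
  inside-∩ X Y (a , b) eq eq′
    with a∈X , b∈X ← inside⇒∈ {X = X} {a} {b} eq | a∈Y , b∈Y ← inside⇒∈ {X = Y} {a} {b} eq′ =
    ∈⇒inside (SubP.x∈p∩q⁺ (a∈X , a∈Y)) (SubP.x∈p∩q⁺ (b∈X , b∈Y))

  bit-mono : ∀ b c → (b ≡ true → c ≡ true) → bit b ≤ bit c
  bit-mono false c b⇒c = z≤n
  bit-mono true  c b⇒c rewrite b⇒c refl = ℕP.≤-refl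

  bit-supermodular : ∀ x y u m → (x ≡ true → u ≡ true) → (y ≡ true → u ≡ true) →
    (x ≡ true → y ≡ true → m ≡ true) → bit x + bit y ≤ bit u + bit m
  bit-supermodular false false u m xu yu xym = z≤n
  bit-supermodular false true  u m xu yu xym rewrite yu refl = s≤s z≤n
  bit-supermodular true  false u m xu yu xym rewrite xu refl = s≤s z≤n
  bit-supermodular true  true  u m xu yu xym rewrite xu refl | xym refl refl = ℕP.≤-refl

  bit-supermodular₃ : ∀ x y z u k l m →
    (x ≡ true → u ≡ true) → (y ≡ true → u ≡ true) → (z ≡ true → u ≡ true) →
    (x ≡ true → y ≡ true → k ≡ true) → (y ≡ true → z ≡ true → l ≡ true) → (z ≡ true → x ≡ true → m ≡ true) →
    bit x + bit y + bit z ≤ bit u + (bit k + bit l + bit m)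
  bit-supermodular₃ false false false u k l m xu yu zu xyk yzl zxm = z≤n
  bit-supermodular₃ true  false false u k l m xu yu zu xyk yzl zxm rewrite xu refl = s≤s z≤n
  bit-supermodular₃ false true  false u k l m xu yu zu xyk yzl zxm rewrite yu refl = s≤s z≤n
  bit-supermodular₃ false false true  u k l m xu yu zu xyk yzl zxm rewrite zu refl = s≤s z≤n
  bit-supermodular₃ true  true  false u k l m xu yu zu xyk yzl zxm rewrite xu refl | xyk refl refl = s≤s (s≤s z≤n)
  bit-supermodular₃ false true  true  u k l m xu yu zu xyk yzl zxm rewrite yu refl | yzl refl refl =
    s≤s (ℕP.≤-trans (ℕP.m≤n+m 1 (bit k)) (ℕP.m≤m+n _ _))
  bit-supermodular₃ true  false true  u k l m xu yu zu xyk yzl zxm rewrite xu refl | zxm refl refl =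
    s≤s (ℕP.m≤n+m 1 (bit k + bit l))
  bit-supermodular₃ true  true  true  u k l m xu yu zu xyk yzl zxm
    rewrite xu refl | xyk refl refl | yzl refl refl | zxm refl refl = s≤s (s≤s (s≤s z≤n))

  induced-mono : ∀ {X Y : Subset n} E → X ⊆ Y → induced X E ≤ induced Y E
  induced-mono []      X⊆Y = z≤n
  induced-mono {X = X} (e ∷ E) X⊆Y =
    ℕP.+-mono-≤ (bit-mono _ _ (inside-mono X e X⊆Y)) (induced-mono E X⊆Y)

  induced-supermodular : ∀ (X Y : Subset n) E →
    induced X E + induced Y E ≤ induced (X ∪ Y) E + induced (X ∩ Y) E
  induced-supermodular X Y []      = z≤n
  induced-supermodular X Y (e ∷ E) = begin
    (bit x + induced X E) + (bit y + induced Y E)   ≡⟨ interchange (bit x) (induced X E) (bit y) (induced Y E) ⟩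
    (bit x + bit y) + (induced X E + induced Y E)   ≤⟨ ℕP.+-mono-≤ (bit-supermodular x y u x∩y
        (inside-mono X e (SubP.p⊆p∪q Y)) (inside-mono Y e (SubP.q⊆p∪q X Y)) (inside-∩ X Y e))
        (induced-supermodular X Y E) ⟩
    (bit u + bit x∩y) + (induced (X ∪ Y) E + induced (X ∩ Y) E)
      ≡⟨ interchange (bit u) (bit x∩y) (induced (X ∪ Y) E) (induced (X ∩ Y) E) ⟩
    (bit u + induced (X ∪ Y) E) + (bit x∩y + induced (X ∩ Y) E) ∎
    where
    open ℕP.≤-Reasoning
    x = edgeInside X e
    y = edgeInside Y e
    u = edgeInside (X ∪ Y) e
    x∩y = edgeInside (X ∩ Y) e
    interchange : ∀ a b c d → (a + b) + (c + d) ≡ (a + c) + (b + d)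
    interchange = ℕSolver.solve-∀

  -- An edge inside exactly j of the three sets is counted j times on the left and, if j is
  -- positive, 1 + j(j - 1)/2 times on the right.
  induced-supermodular₃ : ∀ (X Y Z : Subset n) E →
    induced X E + induced Y E + induced Z E ≤
    induced ((X ∪ Y) ∪ Z) E + (induced (X ∩ Y) E + induced (Y ∩ Z) E + induced (Z ∩ X) E)
  induced-supermodular₃ X Y Z []      = z≤n
  induced-supermodular₃ X Y Z (e ∷ E) = begin
    (bit x + induced X E) + (bit y + induced Y E) + (bit z + induced Z E)
      ≡⟨ regroup (bit x) (bit y) (bit z) (induced X E) (induced Y E) (induced Z E) ⟩
    (bit x + bit y + bit z) + (induced X E + induced Y E + induced Z E)
      ≤⟨ ℕP.+-mono-≤ (bit-supermodular₃ x y z u x∩y y∩z z∩x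
           (inside-mono X e (λ a∈X → SubP.p⊆p∪q Z (SubP.p⊆p∪q Y a∈X)))
           (inside-mono Y e (λ a∈Y → SubP.p⊆p∪q Z (SubP.q⊆p∪q X Y a∈Y)))
           (inside-mono Z e (SubP.q⊆p∪q (X ∪ Y) Z))
           (inside-∩ X Y e) (inside-∩ Y Z e) (inside-∩ Z X e))
         (induced-supermodular₃ X Y Z E) ⟩
    (bit u + (bit x∩y + bit y∩z + bit z∩x)) +
    (induced ((X ∪ Y) ∪ Z) E + (induced (X ∩ Y) E + induced (Y ∩ Z) E + induced (Z ∩ X) E))
      ≡⟨ regroup′ (bit u) (bit x∩y) (bit y∩z) (bit z∩x) _ (induced (X ∩ Y) E) _ _ ⟩
    (bit u + induced ((X ∪ Y) ∪ Z) E) +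
    ((bit x∩y + induced (X ∩ Y) E) + (bit y∩z + induced (Y ∩ Z) E) + (bit z∩x + induced (Z ∩ X) E)) ∎
    where
    open ℕP.≤-Reasoning
    x = edgeInside X e
    y = edgeInside Y e
    z = edgeInside Z e
    u = edgeInside ((X ∪ Y) ∪ Z) e
    x∩y = edgeInside (X ∩ Y) e
    y∩z = edgeInside (Y ∩ Z) e
    z∩x = edgeInside (Z ∩ X) e
    regroup : ∀ a b c i j k → (a + i) + (b + j) + (c + k) ≡ (a + b + c) + (i + j + k)
    regroup = ℕSolver.solve-∀
    regroup′ : ∀ u k l m U K L M →
      (u + (k + l + m)) + (U + (K + L + M)) ≡ (u + U) + ((k + K) + (l + L) + (m + M))
    regroup′ = ℕSolver.solve-∀

  induced-↭ : ∀ (X : Subset n) {E F} → E ↭ F → induced X E ≡ induced X F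
  induced-↭ X Perm.refl         = refl
  induced-↭ X (Perm.prep e p)   = cong (bit (edgeInside X e) +_) (induced-↭ X p)
  induced-↭ X (Perm.swap e f p) =
    trans (cong (λ k → bit (edgeInside X e) + (bit (edgeInside X f) + k)) (induced-↭ X p))
      (left-comm (bit (edgeInside X e)) (bit (edgeInside X f)) _)
    where
    left-comm : ∀ a b c → a + (b + c) ≡ b + (a + c)
    left-comm = ℕSolver.solve-∀
  induced-↭ X (Perm.trans p q)  = trans (induced-↭ X p) (induced-↭ X q)

  Laman-resp : ∀ {E F : List (Edge n)} → (∀ X → induced X E ≡ induced X F) → Laman E → Laman F
  Laman-resp {E = E} {F} eq laman = sparse λ X → subst (λ k → 1 ≤ k → k + 3 ≤ 2 * ∣ X ∣) (eq X) (bound laman X)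

  Laman-tail : ∀ {e} {E : List (Edge n)} → Laman (e ∷ E) → Laman E
  Laman-tail {e = e} {E} laman = sparse λ X nonempty →
    ℕP.≤-trans (ℕP.+-monoˡ-≤ 3 (grow X)) (bound laman X (ℕP.≤-trans nonempty (grow X)))
    where
    grow : ∀ X → induced X E ≤ induced X (e ∷ E)
    grow X = ℕP.m≤n+m (induced X E) (bit (edgeInside X e))

  bit-inside : ∀ {X : Subset n} {a b} → a Sub.∈ X → b Sub.∈ X → bit (edgeInside X (a , b)) ≡ 1
  bit-inside a∈X b∈X = cong bit (∈⇒inside a∈X b∈X)

  no-loop : ∀ {v a} {E : List (Edge n)} → Laman ((v , a) ∷ E) → v ≢ a
  no-loop {v = v} {E = E} laman refl = ℕP.<⇒≱ too-big (bound laman ⁅ v ⁆ (ℕP.≤-trans (s≤s z≤n) one))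
    where
    one : 1 ≤ induced ⁅ v ⁆ ((v , v) ∷ E)
    one rewrite bit-inside (SubP.x∈⁅x⁆ v) (SubP.x∈⁅x⁆ v) = s≤s z≤n
    too-big : 2 * ∣ ⁅ v ⁆ ∣ < induced ⁅ v ⁆ ((v , v) ∷ E) + 3
    too-big rewrite SubP.∣⁅x⁆∣≡1 v = ℕP.≤-trans (ℕP.n≤1+n 3) (ℕP.+-monoˡ-≤ 3 one)

  no-parallel : ∀ {v a b} {E : List (Edge n)} → Laman ((v , a) ∷ (v , b) ∷ E) → a ≢ b
  no-parallel {v = v} {a} {E = E} laman refl = ℕP.<⇒≱ too-big (bound laman X (ℕP.≤-trans (s≤s z≤n) two))
    where
    X = ⁅ v ⁆ ∪ ⁅ a ⁆
    v∈X = SubP.p⊆p∪q ⁅ a ⁆ (SubP.x∈⁅x⁆ v)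
    a∈X = SubP.q⊆p∪q ⁅ v ⁆ ⁅ a ⁆ (SubP.x∈⁅x⁆ a)
    two : 2 ≤ induced X ((v , a) ∷ (v , a) ∷ E)
    two rewrite bit-inside v∈X a∈X = s≤s (s≤s z≤n)
    X≤2 : ∣ X ∣ ≤ 2
    X≤2 = ℕP.≤-trans (∣∪∣≤ ⁅ v ⁆ ⁅ a ⁆) (ℕP.≤-reflexive (cong₂ _+_ (SubP.∣⁅x⁆∣≡1 v) (SubP.∣⁅x⁆∣≡1 a)))
    too-big : 2 * ∣ X ∣ < induced X ((v , a) ∷ (v , a) ∷ E) + 3
    too-big = ℕP.≤-trans (s≤s (ℕP.*-monoʳ-≤ 2 X≤2)) (ℕP.+-monoˡ-≤ 3 two)

  -- Tight sets through `a` and `b`. Only the inequality is kept, and `a` may equal `b`: the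
  -- singleton then blocks the loop.
  Blocks : List (Edge n) → Fin n → Fin n → Subset n → Set
  Blocks E a b X = a Sub.∈ X × b Sub.∈ X × 2 * ∣ X ∣ ≤ induced X E + 3

  -- A new edge raises the count only for sets containing both ends, and by one, so it can break
  -- sparsity only at a set that was already tight. The finitely many subsets are searched for one.
  add-edge : ∀ {E : List (Edge n)} → Laman E → ∀ a b → Laman ((a , b) ∷ E) ⊎ ∃ (Blocks E a b)
  add-edge {E = E} laman a b
    with SubP.anySubset? (λ X → (a SubP.∈? X) ×-dec (b SubP.∈? X) ×-dec (2 * ∣ X ∣ ℕP.≤? induced X E + 3))
  ... | yes blocked  = inj₂ blocked
  ... | no ¬blocked = inj₁ (sparse extended)
    where
    extended : ∀ X → 1 ≤ induced X ((a , b) ∷ E) → induced X ((a , b) ∷ E) + 3 ≤ 2 * ∣ X ∣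
    extended X nonempty with edgeInside X (a , b) in eq
    ... | false = bound laman X nonempty
    ... | true  = ℕP.≰⇒> λ tight →
        ¬blocked (X , proj₁ (inside⇒∈ {X = X} {a} {b} eq) , proj₂ (inside⇒∈ {X = X} {a} {b} eq) , tight)

  Avoids : Fin n → List (Edge n) → Set
  Avoids v = Spanned (∁ ⁅ v ⁆)

  -- Trading a vertex of degree three for an edge between two of its neighbours.

  module DegreeThree {n} {v a b c : Fin n} {E : List (Edge n)}
    (laman : Laman ((v , a) ∷ (v , b) ∷ (v , c) ∷ E)) where

    laman-rest : Laman E
    laman-rest = Laman-tail (Laman-tail (Laman-tail laman))

    -- Adding `v` to `Q` brings three edges but at most one vertex, so `Q` must stay one edge below
    -- the general bound 2|Q| - 3.
    contains-all : ∀ Q → a Sub.∈ Q → b Sub.∈ Q → c Sub.∈ Q → induced Q E + 4 ≤ 2 * ∣ Q ∣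
    contains-all Q a∈Q b∈Q c∈Q = ℕP.+-cancelʳ-≤ 2 _ _ (begin
      induced Q E + 4 + 2          ≡⟨ shift₁ (induced Q E) ⟩
      3 + induced Q E + 3          ≤⟨ ℕP.+-monoˡ-≤ 3 (ℕP.+-monoʳ-≤ 3 (induced-mono E (SubP.p⊆p∪q ⁅ v ⁆))) ⟩
      3 + induced Q⁺ E + 3         ≡⟨ cong (_+ 3) (sym star) ⟩
      induced Q⁺ ((v , a) ∷ (v , b) ∷ (v , c) ∷ E) + 3 ≤⟨ bound laman Q⁺ (ℕP.≤-trans (s≤s z≤n) (ℕP.≤-reflexive (sym star))) ⟩
      2 * ∣ Q⁺ ∣                   ≤⟨ ℕP.*-monoʳ-≤ 2 (∣∪∣≤ Q ⁅ v ⁆) ⟩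
      2 * (∣ Q ∣ + ∣ ⁅ v ⁆ ∣)      ≡⟨ cong (λ k → 2 * (∣ Q ∣ + k)) (SubP.∣⁅x⁆∣≡1 v) ⟩
      2 * (∣ Q ∣ + 1)              ≡⟨ shift₂ ∣ Q ∣ ⟩
      2 * ∣ Q ∣ + 2                ∎)
      where
      open ℕP.≤-Reasoning
      Q⁺ = Q ∪ ⁅ v ⁆
      v∈ = SubP.q⊆p∪q Q ⁅ v ⁆ (SubP.x∈⁅x⁆ v)
      shift₁ : ∀ k → k + 4 + 2 ≡ 3 + k + 3
      shift₁ = ℕSolver.solve-∀
      shift₂ : ∀ k → 2 * (k + 1) ≡ 2 * k + 2
      shift₂ = ℕSolver.solve-∀
      star : induced Q⁺ ((v , a) ∷ (v , b) ∷ (v , c) ∷ E) ≡ 3 + induced Q⁺ E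
      star rewrite bit-inside v∈ (SubP.p⊆p∪q ⁅ v ⁆ a∈Q) | bit-inside v∈ (SubP.p⊆p∪q ⁅ v ⁆ b∈Q)
                 | bit-inside v∈ (SubP.p⊆p∪q ⁅ v ⁆ c∈Q) = refl

    -- Two tight sets sharing an edge have a tight union; but no set containing all three
    -- neighbours of v is tight, since adding v would violate sparsity.
    no-common-edge : ∀ X Y → 2 * ∣ X ∣ ≤ induced X E + 3 → 2 * ∣ Y ∣ ≤ induced Y E + 3 →
      a Sub.∈ X ∪ Y → b Sub.∈ X ∪ Y → c Sub.∈ X ∪ Y → induced (X ∩ Y) E ≡ 0
    no-common-edge X Y tightX tightY a∈ b∈ c∈ with induced (X ∩ Y) E in eq
    ... | zero  = refl
    ... | suc k = ⊥-elim (ℕP.1+n≰n (begin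
      suc (2 * ∣ X ∣ + 2 * ∣ Y ∣ + (induced X E + induced Y E))
        ≤⟨ s≤s (ℕP.+-mono-≤ (ℕP.+-mono-≤ tightX tightY) (induced-supermodular X Y E)) ⟩
      suc (induced X E + 3 + (induced Y E + 3) + (induced (X ∪ Y) E + induced (X ∩ Y) E))
        ≡⟨ regroup (induced X E) (induced Y E) (induced (X ∪ Y) E) (induced (X ∩ Y) E) ⟩
      (induced X E + induced Y E) + ((induced (X ∪ Y) E + 4) + (induced (X ∩ Y) E + 3))
        ≤⟨ ℕP.+-monoʳ-≤ (induced X E + induced Y E) (ℕP.+-mono-≤ (contains-all (X ∪ Y) a∈ b∈ c∈)
             (bound laman-rest (X ∩ Y) (subst (1 ≤_) (sym eq) (s≤s z≤n)))) ⟩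
      (induced X E + induced Y E) + (2 * ∣ X ∪ Y ∣ + 2 * ∣ X ∩ Y ∣)
        ≡⟨ cong (induced X E + induced Y E +_) (trans (sym (ℕP.*-distribˡ-+ 2 ∣ X ∪ Y ∣ _))
             (trans (cong (2 *_) (∣∪∣+∣∩∣ X Y)) (ℕP.*-distribˡ-+ 2 (∣ X ∣) (∣ Y ∣)))) ⟩
      (induced X E + induced Y E) + (2 * ∣ X ∣ + 2 * ∣ Y ∣)
        ≡⟨ ℕP.+-comm (induced X E + induced Y E) _ ⟩
      2 * ∣ X ∣ + 2 * ∣ Y ∣ + (induced X E + induced Y E) ∎))
      where
      open ℕP.≤-Reasoning
      regroup : ∀ x y u m → suc (x + 3 + (y + 3) + (u + m)) ≡ (x + y) + ((u + 4) + (m + 3))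
      regroup = ℕSolver.solve-∀

    a≢c : a ≢ c
    a≢c = no-parallel {v = v} {E = (v , b) ∷ E} (Laman-resp {E = (v , a) ∷ (v , b) ∷ (v , c) ∷ E}
      (λ X → induced-↭ X (Perm.prep _ (Perm.swap _ _ (Perm.refl {xs = E})))) laman)

    -- The three tight sets pairwise share no edge, so their union `W` induces at least 2(|X| + |Y|
    -- + |Z|) - 9 edges. But `W` has at most |X| + |Y| + |Z| - 3 vertices and contains `a`, `b` and
    -- `c`, so `contains-all` allows at most 2(|X| + |Y| + |Z|) - 10.
    not-all-blocked : ∀ {X Y Z} → Blocks E a b X → Blocks E b c Y → Blocks E c a Z → ⊥
    not-all-blocked {X} {Y} {Z} (a∈X , b∈X , tightX) (b∈Y , c∈Y , tightY) (c∈Z , a∈Z , tightZ) =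
      ℕP.1+n≰n (begin
        suc (induced X E + induced Y E + induced Z E + 9)
          ≤⟨ s≤s (ℕP.+-monoˡ-≤ 9 edges) ⟩
        suc (induced W E + 9)
          ≡⟨ regroup₁ (induced W E) ⟩
        (induced W E + 4) + 6
          ≤⟨ ℕP.+-monoˡ-≤ 6 (contains-all W (left a∈X) (left b∈X) (SubP.p⊆p∪q Z (SubP.q⊆p∪q X Y c∈Y))) ⟩
        2 * ∣ W ∣ + 6
          ≡⟨ regroup₂ ∣ W ∣ ⟩
        2 * (∣ W ∣ + 3)
          ≤⟨ ℕP.*-monoʳ-≤ 2 vertices ⟩
        2 * (∣ X ∣ + ∣ Y ∣ + ∣ Z ∣)
          ≡⟨ regroup₃ (∣ X ∣) (∣ Y ∣) (∣ Z ∣) ⟩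
        2 * ∣ X ∣ + 2 * ∣ Y ∣ + 2 * ∣ Z ∣
          ≤⟨ ℕP.+-mono-≤ (ℕP.+-mono-≤ tightX tightY) tightZ ⟩
        (induced X E + 3) + (induced Y E + 3) + (induced Z E + 3)
          ≡⟨ regroup₄ (induced X E) (induced Y E) (induced Z E) ⟩
        induced X E + induced Y E + induced Z E + 9 ∎)
      where
      open ℕP.≤-Reasoning
      W = (X ∪ Y) ∪ Z
      left : ∀ {x} → x Sub.∈ X → x Sub.∈ W
      left x∈X = SubP.p⊆p∪q Z (SubP.p⊆p∪q Y x∈X)
      regroup₁ : ∀ w → suc (w + 9) ≡ (w + 4) + 6
      regroup₁ = ℕSolver.solve-∀
      regroup₂ : ∀ w → 2 * w + 6 ≡ 2 * (w + 3)
      regroup₂ = ℕSolver.solve-∀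
      regroup₃ : ∀ x y z → 2 * (x + y + z) ≡ 2 * x + 2 * y + 2 * z
      regroup₃ = ℕSolver.solve-∀
      regroup₄ : ∀ x y z → (x + 3) + (y + 3) + (z + 3) ≡ x + y + z + 9
      regroup₄ = ℕSolver.solve-∀
      edges : induced X E + induced Y E + induced Z E ≤ induced W E
      edges = subst (induced X E + induced Y E + induced Z E ≤_)
        (trans (cong (induced W E +_) (cong₂ _+_ (cong₂ _+_
            (no-common-edge X Y tightX tightY (SubP.p⊆p∪q Y a∈X) (SubP.p⊆p∪q Y b∈X) (SubP.q⊆p∪q X Y c∈Y))
            (no-common-edge Y Z tightY tightZ (SubP.q⊆p∪q Y Z a∈Z) (SubP.p⊆p∪q Z b∈Y) (SubP.p⊆p∪q Z c∈Y)))
            (no-common-edge Z X tightZ tightX (SubP.p⊆p∪q X a∈Z) (SubP.q⊆p∪q Z X b∈X) (SubP.p⊆p∪q X c∈Z))))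
          (ℕP.+-identityʳ _))
        (induced-supermodular₃ X Y Z E)
      -- The 3 counts `a` and `c` in the overlap of `Z` with `X ∪ Y`, and `b` in the overlap of `X`
      -- with `Y`. These overlaps may be larger.
      vertices : ∣ W ∣ + 3 ≤ ∣ X ∣ + ∣ Y ∣ + ∣ Z ∣
      vertices = begin
        ∣ W ∣ + 3                                       ≤⟨ ℕP.+-monoʳ-≤ ∣ W ∣ (ℕP.+-mono-≤
            (2≤∣∣ (SubP.x∈p∩q⁺ (SubP.p⊆p∪q Y a∈X , a∈Z)) (SubP.x∈p∩q⁺ (SubP.q⊆p∪q X Y c∈Y , c∈Z)) a≢c)
            (1≤∣∣ (SubP.x∈p∩q⁺ (b∈X , b∈Y)))) ⟩
        ∣ W ∣ + (∣ (X ∪ Y) ∩ Z ∣ + ∣ X ∩ Y ∣)           ≡⟨ ℕP.+-assoc ∣ W ∣ _ _ ⟨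
        ∣ W ∣ + ∣ (X ∪ Y) ∩ Z ∣ + ∣ X ∩ Y ∣             ≡⟨ cong (_+ ∣ X ∩ Y ∣) (∣∪∣+∣∩∣ (X ∪ Y) Z) ⟩
        ∣ X ∪ Y ∣ + ∣ Z ∣ + ∣ X ∩ Y ∣                   ≡⟨ rotate (∣ X ∪ Y ∣) (∣ Z ∣) (∣ X ∩ Y ∣) ⟩
        ∣ X ∪ Y ∣ + ∣ X ∩ Y ∣ + ∣ Z ∣                   ≡⟨ cong (_+ ∣ Z ∣) (∣∪∣+∣∩∣ X Y) ⟩
        ∣ X ∣ + ∣ Y ∣ + ∣ Z ∣                           ∎
        where
        rotate : ∀ x y z → x + y + z ≡ x + z + y
        rotate = ℕSolver.solve-∀

    reducible : Laman ((a , b) ∷ E) ⊎ Laman ((b , c) ∷ E) ⊎ Laman ((c , a) ∷ E)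
    reducible with add-edge laman-rest a b | add-edge laman-rest b c | add-edge laman-rest c a
    ... | inj₁ ab | _       | _       = inj₁ ab
    ... | inj₂ _  | inj₁ bc | _       = inj₂ (inj₁ bc)
    ... | inj₂ _  | inj₂ _  | inj₁ ca = inj₂ (inj₂ ca)
    ... | inj₂ (_ , X) | inj₂ (_ , Y) | inj₂ (_ , Z) = ⊥-elim (not-all-blocked X Y Z)

  from-does : ∀ {A : Set} (A? : Dec A) → does A? ≡ true → A
  from-does (yes a) _ = a

  hits : Fin n → Fin n → ℕ
  hits v a = bit (does (v FinP.≟ a))

  degree : Fin n → List (Edge n) → ℕ
  degree v []            = 0
  degree v ((a , b) ∷ E) = (hits v a + hits v b) + degree v E

  orient : Fin n → Edge n → Edge n
  orient v (a , b) = if does (v FinP.≟ b) then (b , a) else (a , b)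

  double-suc : ∀ k → 2 + 2 * k ≡ 2 * suc k
  double-suc = ℕSolver.solve-∀

  -- A loop at `v` counts twice in the degree but contributes one entry to `us`, hence two bounds in
  -- place of an equality. They suffice to turn a degree between 1 and 3 into one to three
  -- neighbours.
  star : ∀ (v : Fin n) E → ∃₂ λ us E′ → Avoids v E′ × map (orient v) E ↭ map (v ,_) us ++ E′ ×
    length us ≤ degree v E × degree v E ≤ 2 * length us
  star v [] = [] , [] , [] , Perm.refl , z≤n , z≤n
  star v ((a , b) ∷ E) with us , E′ , avoids , perm , lo , hi ← star v E | v FinP.≟ a | v FinP.≟ b
  ... | yes refl | yes refl = v ∷ us , E′ , avoids , Perm.prep _ perm , s≤s (ℕP.≤-trans lo (ℕP.n≤1+n _))
                            , ℕP.≤-trans (s≤s (s≤s hi)) (ℕP.≤-reflexive (double-suc (length us)))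
  ... | yes refl | no _     = b ∷ us , E′ , avoids , Perm.prep _ perm , s≤s lo
                            , ℕP.≤-trans (s≤s hi) (ℕP.≤-trans (ℕP.n≤1+n _) (ℕP.≤-reflexive (double-suc (length us))))
  ... | no _     | yes refl = a ∷ us , E′ , avoids , Perm.prep _ perm , s≤s lo
                            , ℕP.≤-trans (s≤s hi) (ℕP.≤-trans (ℕP.n≤1+n _) (ℕP.≤-reflexive (double-suc (length us))))
  ... | no v≢a   | no v≢b   = us , (a , b) ∷ E′ , (outside v≢a , outside v≢b) ∷ avoids
                            , Perm.trans (Perm.prep _ perm) (↭-sym (PermP.shift _ (map (v ,_) us) E′)) , lo , hi
    where
    outside : ∀ {w} → v ≢ w → w Sub.∈ ∁ ⁅ v ⁆
    outside v≢w = SubP.x∉p⇒x∈∁p (SubP.x≢y⇒x∉⁅y⁆ (v≢w ∘ sym))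

  induced-orient : ∀ v (X : Subset n) E → induced X (map (orient v) E) ≡ induced X E
  induced-orient v X []            = refl
  induced-orient v X ((a , b) ∷ E) = cong₂ (λ x k → bit x + k) (head (does (v FinP.≟ b))) (induced-orient v X E)
    where
    open import Data.Bool.Properties using (∧-comm)
    head : ∀ x → edgeInside X (if x then (b , a) else (a , b)) ≡ edgeInside X (a , b)
    head true  = ∧-comm (Vec.lookup X b) (Vec.lookup X a)
    head false = refl

  ∑ℕ : ∀ {A : Set} → List A → (A → ℕ) → ℕ
  ∑ℕ []       f = 0
  ∑ℕ (x ∷ xs) f = f x + ∑ℕ xs f

  ∑ℕ-+ : ∀ {A : Set} (xs : List A) f g → ∑ℕ xs (λ x → f x + g x) ≡ ∑ℕ xs f + ∑ℕ xs g
  ∑ℕ-+ []       f g = refl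
  ∑ℕ-+ (x ∷ xs) f g = trans (cong (f x + g x +_) (∑ℕ-+ xs f g)) (interchange (f x) (g x) _ _)
    where
    interchange : ∀ a b c d → (a + b) + (c + d) ≡ (a + c) + (b + d)
    interchange = ℕSolver.solve-∀

  ∑ℕ-lower : ∀ {A : Set} k (xs : List A) {f} → All (λ x → k ≤ f x) xs → length xs * k ≤ ∑ℕ xs f
  ∑ℕ-lower k []       []         = z≤n
  ∑ℕ-lower k (x ∷ xs) (kx ∷ kxs) = ℕP.+-mono-≤ kx (∑ℕ-lower k xs kxs)

  ∑-hits : ∀ {xs : List (Fin n)} → Unique xs → ∀ a → ∑ℕ xs (λ v → hits v a) ≤ 1
  ∑-hits [] a = z≤n
  ∑-hits {xs = x ∷ xs} (x∉xs ∷ unique) a with x FinP.≟ a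
  ... | no _     = ∑-hits unique a
  ... | yes refl = s≤s (ℕP.≤-reflexive (absent x∉xs))
    where
    absent : ∀ {ys} → All (x ≢_) ys → ∑ℕ ys (λ v → hits v x) ≡ 0
    absent []                    = refl
    absent {y ∷ ys} (x≢y ∷ rest) rewrite dec-false (y FinP.≟ x) (x≢y ∘ sym) = absent rest

  -- Among distinct vertices each end of an edge is hit at most once. This half of the handshake
  -- lemma is all that the degree count uses.
  ∑-degree : ∀ {xs : List (Fin n)} → Unique xs → ∀ E → ∑ℕ xs (λ v → degree v E) ≤ 2 * length E
  ∑-degree {xs = xs} unique [] = ℕP.≤-reflexive (zeros xs)
    where
    zeros : ∀ ys → ∑ℕ ys (λ _ → 0) ≡ 0
    zeros []       = refl
    zeros (y ∷ ys) = zeros ys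
  ∑-degree {xs = xs} unique ((a , b) ∷ E) = begin
    ∑ℕ xs (λ v → (hits v a + hits v b) + degree v E)
      ≡⟨ trans (∑ℕ-+ xs _ _) (cong (_+ ∑ℕ xs (λ v → degree v E)) (∑ℕ-+ xs _ _)) ⟩
    (∑ℕ xs (λ v → hits v a) + ∑ℕ xs (λ v → hits v b)) + ∑ℕ xs (λ v → degree v E)
      ≤⟨ ℕP.+-mono-≤ (ℕP.+-mono-≤ (∑-hits unique a) (∑-hits unique b)) (∑-degree unique E) ⟩
    2 + 2 * length E
      ≡⟨ double-suc (length E) ⟩
    2 * suc (length E) ∎
    where open ℕP.≤-Reasoning

  select-unique : ∀ (S : Subset n) → Unique (select S)
  select-unique Vec.[]            = []
  select-unique (true  Vec.∷ S) =
    AllP.map⁺ (All.universal (λ _ ()) (select S)) ∷ UniqueP.map⁺ FinP.suc-injective (select-unique S)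
  select-unique (false Vec.∷ S) = UniqueP.map⁺ FinP.suc-injective (select-unique S)

  hits-self : ∀ (a : Fin n) → hits a a ≡ 1
  hits-self a rewrite dec-true (a FinP.≟ a) refl = refl

  spanned⇒induced : ∀ {X : Subset n} {E} → Spanned X E → induced X E ≡ length E
  spanned⇒induced []                      = refl
  spanned⇒induced ((a∈X , b∈X) ∷ spanned) = cong₂ _+_ (bit-inside a∈X b∈X) (spanned⇒induced spanned)

  -- Otherwise all degrees in the support X are at least 4, and the degree sum gives
  -- 4 |X| ≤ 2 |E| ≤ 4 |X| - 6.
  low-degree : ∀ {E : List (Edge n)} → 1 ≤ length E → Laman E → ∃ λ v → 1 ≤ degree v E × degree v E ≤ 3
  low-degree {n} {E} nonempty laman
    with FinP.any? (λ v → (1 ℕP.≤? degree v E) ×-dec (degree v E ℕP.≤? 3))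
  ... | yes found = found
  ... | no ¬found = ⊥-elim (ℕP.1+n≰n (begin
      suc (2 * length E)                       ≤⟨ ℕP.m≤n+m _ 5 ⟩
      5 + suc (2 * length E)                   ≡⟨ regroup (length E) ⟩
      2 * (length E + 3)                       ≡⟨ cong (λ k → 2 * (k + 3)) (sym all-induced) ⟩
      2 * (induced X E + 3)                    ≤⟨ ℕP.*-monoʳ-≤ 2 (bound laman X (subst (1 ≤_) (sym all-induced) nonempty)) ⟩
      2 * (2 * ∣ X ∣)                          ≡⟨ quadruple ∣ X ∣ ⟩
      ∣ X ∣ * 4                                ≡⟨ cong (_* 4) (sym (length-select X)) ⟩
      length (select X) * 4                    ≤⟨ ∑ℕ-lower 4 (select X) (All.tabulate λ v∈ → high (∈-select⁻ v∈)) ⟩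
      ∑ℕ (select X) (λ v → degree v E)         ≤⟨ ∑-degree (select-unique X) E ⟩
      2 * length E                             ∎))
    where
    open ℕP.≤-Reasoning
    regroup : ∀ k → 5 + suc (2 * k) ≡ 2 * (k + 3)
    regroup = ℕSolver.solve-∀
    quadruple : ∀ k → 2 * (2 * k) ≡ k * 4
    quadruple = ℕSolver.solve-∀
    X : Subset n
    X = Vec.tabulate λ v → does (1 ℕP.≤? degree v E)
    ∈X⁺ : ∀ {v} → 1 ≤ degree v E → v Sub.∈ X
    ∈X⁺ {v} pos = VecP.lookup⇒[]= v X (trans (VecP.lookup∘tabulate _ v) (dec-true (1 ℕP.≤? degree v E) pos))
    ∈X⁻ : ∀ {v} → v Sub.∈ X → 1 ≤ degree v E
    ∈X⁻ {v} v∈X = from-does (1 ℕP.≤? degree v E)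
      (trans (sym (VecP.lookup∘tabulate (λ v → does (1 ℕP.≤? degree v E)) v)) (VecP.[]=⇒lookup v∈X))
    high : ∀ {v} → v Sub.∈ X → 4 ≤ degree v E
    high {v} v∈X = ℕP.≰⇒> λ low → ¬found (v , ∈X⁻ v∈X , low)
    ends : ∀ F → (∀ {v} → 1 ≤ degree v F → v Sub.∈ X) → Spanned X F
    ends []            mem = []
    ends ((a , b) ∷ F) mem =
      ( mem (ℕP.≤-trans (ℕP.≤-reflexive (sym (hits-self a))) (ℕP.≤-trans (ℕP.m≤m+n _ (hits a b)) (ℕP.m≤m+n _ (degree a F))))
      , mem (ℕP.≤-trans (ℕP.≤-reflexive (sym (hits-self b))) (ℕP.≤-trans (ℕP.m≤n+m _ (hits b a)) (ℕP.m≤m+n _ (degree b F)))))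
      ∷ ends F (λ {v} pos → mem (ℕP.≤-trans pos (ℕP.m≤n+m (degree v F) (hits v a + hits v b))))
    all-induced : induced X E ≡ length E
    all-induced = spanned⇒induced (ends E ∈X⁺)

-- Sufficiency of Laman's condition by Henneberg's induction.

module Henneberg where
  open ℚ using (ℚ; 0ℚ; 1ℚ; _+_; _*_; _-_; -_)
  open ≡-Reasoning
  open Sums
  open LinearIndependence
  open Polynomials
  open Rigidity
  open Sparsity

  private
    variable
      n : ℕ

  x-axis y-axis : Fin 2
  x-axis = zero
  y-axis = suc zero

  line : Placement* n → Placement* n → ℚ → Placement* n
  line p q t w c = p w c + t * (q w c - p w c)

  line-start : ∀ (p q : Placement* n) w c → line p q 0ℚ w c ≡ p w c
  line-start p q w c = start (p w c) (q w c)
    where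
    start : ∀ x y → x + 0ℚ * (y - x) ≡ x
    start = solve-∀ ℚ-ring

  line-end : ∀ (p q : Placement* n) w c → line p q 1ℚ w c ≡ q w c
  line-end p q w c = end (p w c) (q w c)
    where
    end : ∀ x y → x + 1ℚ * (y - x) ≡ y
    end = solve-∀ ℚ-ring

  line-polynomial : ∀ (p q : Placement* n) w c → Polynomial (λ t → line p q t w c)
  line-polynomial p q w c = constant (p w c) ⊕ identity ⊗ constant (q w c - p w c)

  row-polynomial : ∀ (p q : Placement* n) e c → Polynomial (λ t → row (line p q t) e c)
  row-polynomial p q (a , b) (w , c) =
    if-polynomial (does (w FinP.≟ a)) (line-polynomial p q a c ⊖ line-polynomial p q b c) (constant 0ℚ) ⊕
    if-polynomial (does (w FinP.≟ b)) (line-polynomial p q b c ⊖ line-polynomial p q a c) (constant 0ℚ)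

  row-cong : ∀ {p q : Placement* n} → (∀ w c → p w c ≡ q w c) → ∀ e c → row p e c ≡ row q e c
  row-cong p≗q (a , b) (w , c) = cong₂ _+_
    (cong (at a w) (cong₂ _-_ (p≗q a c) (p≗q b c))) (cong (at b w) (cong₂ _-_ (p≗q b c) (p≗q a c)))

  -- Describes a nonempty Zariski open condition `g p ≢ 0` by its traces on lines. `respects` is
  -- there because a line meets its end points only pointwise, not as equal functions.
  record Observable (g : Placement* n → ℚ) : Set where
    field
      respects : ∀ {p q} → (∀ w c → p w c ≡ q w c) → g p ≡ g q
      along    : ∀ p q → Polynomial (λ t → g (line p q t))
      witness  : Placement* n
      nonzero  : g witness ≢ 0ℚ

  -- At parameter 0 the line from `p` to `witness` is stress-free, and at parameter 1 `g` is
  -- nonzero; `perturb` finds one parameter that has both properties.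
  generic : ∀ {E : List (Edge n)} {g} → Observable g → ∀ {p} → StressFree p E → ∃ λ q → StressFree q E × g q ≢ 0ℚ
  generic {g = g} obs {p} free =
    let t , free′ , g≢0 = perturb (λ t → row (line p witness t)) (row-polynomial p witness) {0ℚ} {1ℚ}
          (independent-cong {r = row p} (row-cong (λ w c → sym (line-start p witness w c))) free)
          (along p witness)
          (λ g≡0 → nonzero (trans (respects λ w c → sym (line-end p witness w c)) g≡0))
    in line p witness t , free′ , g≢0
    where open Observable obs

  displacement-x : Fin n → Fin n → Placement* n → ℚ
  displacement-x v a p = p v x-axis - p a x-axis

  -- Twice the signed area of the triangle a b c.
  area : Fin n → Fin n → Fin n → Placement* n → ℚ
  area a b c p = (p b x-axis - p a x-axis) * (p c y-axis - p a y-axis)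
               - (p b y-axis - p a y-axis) * (p c x-axis - p a x-axis)

  displacement-observable : ∀ {v a : Fin n} → v ≢ a → Observable (displacement-x v a)
  displacement-observable {n} {v} {a} v≢a = record
    { respects = λ p≗q → cong₂ _-_ (p≗q v x-axis) (p≗q a x-axis)
    ; along    = λ p q → line-polynomial p q v x-axis ⊖ line-polynomial p q a x-axis
    ; witness  = λ w _ → at v w 1ℚ
    ; nonzero  = subst (_≢ 0ℚ) (sym (cong₂ _-_ (at-≡ v 1ℚ) (at-≢ 1ℚ (v≢a ∘ sym)))) λ ()
    }

  area-observable : ∀ {a b c : Fin n} → a ≢ b → a ≢ c → b ≢ c → Observable (area a b c)
  area-observable {n} {a} {b} {c} a≢b a≢c b≢c = record
    { respects = λ p≗q → cong₂ _-_
        (cong₂ _*_ (cong₂ _-_ (p≗q b x-axis) (p≗q a x-axis)) (cong₂ _-_ (p≗q c y-axis) (p≗q a y-axis)))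
        (cong₂ _*_ (cong₂ _-_ (p≗q b y-axis) (p≗q a y-axis)) (cong₂ _-_ (p≗q c x-axis) (p≗q a x-axis)))
    ; along    = λ p q →
        (line-polynomial p q b x-axis ⊖ line-polynomial p q a x-axis) ⊗
        (line-polynomial p q c y-axis ⊖ line-polynomial p q a y-axis) ⊖
        (line-polynomial p q b y-axis ⊖ line-polynomial p q a y-axis) ⊗
        (line-polynomial p q c x-axis ⊖ line-polynomial p q a x-axis)
    ; witness  = unit
    ; nonzero  = subst (_≢ 0ℚ) (sym unit-area) λ ()
    }
    where
    -- `b` sits at (1, 0), `c` at (0, 1) and every other vertex, `a` included, at the origin.
    unit : Placement* n
    unit w zero    = at b w 1ℚ
    unit w (suc _) = at c w 1ℚ
    unit-area : area a b c unit ≡ 1ℚ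
    unit-area = cong₂ _-_
      (cong₂ _*_ (cong₂ _-_ (at-≡ b 1ℚ) (at-≢ 1ℚ a≢b)) (cong₂ _-_ (at-≡ c 1ℚ) (at-≢ 1ℚ a≢c)))
      (cong₂ _*_ (cong₂ _-_ (at-≢ 1ℚ b≢c) (at-≢ 1ℚ a≢c)) (cong₂ _-_ (at-≢ 1ℚ (b≢c ∘ sym)) (at-≢ 1ℚ a≢b)))

  at-linear : ∀ (a w : Fin n) q → at a w q ≡ at a w 1ℚ * q
  at-linear a w q with does (w FinP.≟ a)
  ... | true  = sym (ℚP.*-identityˡ q)
  ... | false = sym (ℚP.*-zeroˡ q)

  row-tail : ∀ (p : Placement* n) {v a} c → v ≢ a → row p (v , a) (v , c) ≡ p v c - p a c
  row-tail p {v} {a} c v≢a = trans (cong₂ _+_ (at-≡ v _) (at-≢ _ v≢a)) (ℚP.+-identityʳ _)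

  total-avoiding : ∀ (p : Placement* n) {v E} W → Avoids v E → map proj₂ W ≡ E → ∀ c → total (row p) W (v , c) ≡ 0ℚ
  total-avoiding p {v} W avoids refl c = total-outside p W avoids c (SubP.x∈p⇒x∉∁p (SubP.x∈⁅x⁆ v))

  total-local : ∀ {p q : Placement* n} {X} → (∀ {a} → a Sub.∈ X → ∀ c → p a c ≡ q a c) →
    ∀ W → Spanned X (map proj₂ W) → ∀ c → total (row p) W c ≡ total (row q) W c
  total-local p≗q []                  []                      c       = refl
  total-local p≗q ((s , a , b) ∷ W) ((a∈X , b∈X) ∷ spanned) (w , c) = cong₂ _+_
    (cong (s *_) (cong₂ _+_ (cong (at a w) (cong₂ _-_ (p≗q a∈X c) (p≗q b∈X c)))
                            (cong (at b w) (cong₂ _-_ (p≗q b∈X c) (p≗q a∈X c)))))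
    (total-local p≗q W spanned (w , c))

  zero-summand : ∀ {s x y} → s ≡ 0ℚ → s * x + y ≡ 0ℚ → y ≡ 0ℚ
  zero-summand {x = x} {y} refl eq = trans (drop x y) eq
    where
    drop : ∀ x y → y ≡ 0ℚ * x + y
    drop = solve-∀ ℚ-ring

  -- Only the edge `v a` meets `v`, so equilibrium at `v` in the x-direction kills its coefficient.
  attach₁ : ∀ {p : Placement* n} {v a E} → Avoids v E → v ≢ a → displacement-x v a p ≢ 0ℚ →
    StressFree p E → StressFree p ((v , a) ∷ E)
  attach₁ {p = p} {v} {a} avoids v≢a d≢0 free ((s , _) ∷ W) refl zero-total =
    s≡0 ∷ free W refl λ {c} c∈ → zero-summand s≡0 (zero-total c∈)
    where
    swap-add : ∀ d s t → d * s ≡ (s * d + t) - t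
    swap-add = solve-∀ ℚ-ring
    s≡0 : s ≡ 0ℚ
    s≡0 = *-nonzero-cancelˡ d≢0 (begin
      displacement-x v a p * s
        ≡⟨ swap-add (displacement-x v a p) s (total (row p) W (v , x-axis)) ⟩
      (s * displacement-x v a p + total (row p) W (v , x-axis)) - total (row p) W (v , x-axis)
        ≡⟨ cong₂ _-_
             (trans (cong (λ d → s * d + total (row p) W (v , x-axis)) (sym (row-tail p x-axis v≢a)))
                    (zero-total (∈-columns (v , x-axis))))
             (total-avoiding p W avoids refl x-axis) ⟩
      0ℚ ∎)

  -- Equilibrium at `v` is a 2 by 2 linear system in the two coefficients, with the area as its
  -- determinant; Cramer's rule solves it.
  attach₂ : ∀ {p : Placement* n} {v a b E} → Avoids v E → v ≢ a → v ≢ b → area v a b p ≢ 0ℚ →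
    StressFree p E → StressFree p ((v , a) ∷ (v , b) ∷ E)
  attach₂ {p = p} {v} {a} {b} avoids v≢a v≢b area≢0 free ((s , _) ∷ (t , _) ∷ W) refl zero-total =
    s≡0 ∷ t≡0 ∷ free W refl λ {c} c∈ → zero-summand t≡0 (zero-summand s≡0 (zero-total c∈))
    where
    at-v : ∀ c → s * (p v c - p a c) + (t * (p v c - p b c) + 0ℚ) ≡ 0ℚ
    at-v c = trans
      (cong₂ (λ x y → s * x + y) (sym (row-tail p c v≢a))
        (cong₂ (λ x y → t * x + y) (sym (row-tail p c v≢b)) (sym (total-avoiding p W avoids refl c))))
      (zero-total (∈-columns (v , c)))
    cramer-s : ∀ s t vx vy ax ay bx by →
      ((ax - vx) * (by - vy) - (ay - vy) * (bx - vx)) * s ≡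
      (s * (vx - ax) + (t * (vx - bx) + 0ℚ)) * (vy - by) - (s * (vy - ay) + (t * (vy - by) + 0ℚ)) * (vx - bx)
    cramer-s = solve-∀ ℚ-ring
    cramer-t : ∀ s t vx vy ax ay bx by →
      ((ax - vx) * (by - vy) - (ay - vy) * (bx - vx)) * t ≡
      (s * (vy - ay) + (t * (vy - by) + 0ℚ)) * (vx - ax) - (s * (vx - ax) + (t * (vx - bx) + 0ℚ)) * (vy - ay)
    cramer-t = solve-∀ ℚ-ring
    vanish : ∀ x y → 0ℚ * x - 0ℚ * y ≡ 0ℚ
    vanish = solve-∀ ℚ-ring
    s≡0 : s ≡ 0ℚ
    s≡0 = *-nonzero-cancelˡ area≢0 (trans
      (cramer-s s t (p v x-axis) (p v y-axis) (p a x-axis) (p a y-axis) (p b x-axis) (p b y-axis))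
      (trans (cong₂ (λ x y → x * (p v y-axis - p b y-axis) - y * (p v x-axis - p b x-axis)) (at-v x-axis) (at-v y-axis))
        (vanish (p v y-axis - p b y-axis) (p v x-axis - p b x-axis))))
    t≡0 : t ≡ 0ℚ
    t≡0 = *-nonzero-cancelˡ area≢0 (trans
      (cramer-t s t (p v x-axis) (p v y-axis) (p a x-axis) (p a y-axis) (p b x-axis) (p b y-axis))
      (trans (cong₂ (λ x y → x * (p v x-axis - p a x-axis) - y * (p v y-axis - p a y-axis)) (at-v y-axis) (at-v x-axis))
        (vanish (p v x-axis - p a x-axis) (p v y-axis - p a y-axis))))

  -- Placing v at 2a - b, on the line a b, makes a stress of the extended graph vanish on v c
  -- and induce a stress with coefficient 2t on the edge a b.
  reflected : Placement* n → Fin n → Fin n → Fin n → Placement* n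
  reflected p v a b w c = if does (w FinP.≟ v) then (p a c + p a c) - p b c else p w c

  reflected-≢ : ∀ (p : Placement* n) {v a b w} → w ≢ v → ∀ c → reflected p v a b w c ≡ p w c
  reflected-≢ p {v} {w = w} w≢v c rewrite dec-false (w FinP.≟ v) w≢v = refl

  reflected-≡ : ∀ (p : Placement* n) v {a b} c → reflected p v a b v c ≡ (p a c + p a c) - p b c
  reflected-≡ p v c rewrite dec-true (v FinP.≟ v) refl = refl

  -- The vectors from `a`, `b`, `c` to `v` are a - b, 2(a - b) and (a - b) + (a - c). As a - b and a
  -- - c are linearly independent, equilibrium at `v` gives u = 0 and s = -2t. The edges at `v` then
  -- pull on `a` and `b` just as an edge `a b` with coefficient 2t would, so the independence of the
  -- smaller graph applies.
  attach₃ : ∀ {p : Placement* n} {v a b c E} → Avoids v E → v ≢ a → v ≢ b → v ≢ c → area a b c p ≢ 0ℚ →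
    StressFree p ((a , b) ∷ E) → StressFree (reflected p v a b) ((v , a) ∷ (v , b) ∷ (v , c) ∷ E)
  attach₃ {n} {p} {v} {a} {b} {c} avoids v≢a v≢b v≢c area≢0 free ((s , _) ∷ (t , _) ∷ (u , _) ∷ W) refl zero-total =
    s≡0 ∷ t≡0 ∷ u≡0 ∷ All.tail free-weights
    where
    q : Placement* n
    q = reflected p v a b
    edge-row : ∀ {x} → v ≢ x → ∀ d → row q (v , x) (v , d) ≡ (p a d + p a d - p b d) - p x d
    edge-row v≢x d = trans (row-tail q d v≢x) (cong₂ _-_ (reflected-≡ p v d) (reflected-≢ p (v≢x ∘ sym) d))
    resultant : Fin 2 → ℚ
    resultant d = s * ((p a d + p a d - p b d) - p a d) + (t * ((p a d + p a d - p b d) - p b d)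
                + (u * ((p a d + p a d - p b d) - p c d) + 0ℚ))
    at-v : ∀ d → resultant d ≡ 0ℚ
    at-v d = trans
      (cong₂ (λ x y → s * x + y) (sym (edge-row v≢a d))
        (cong₂ (λ x y → t * x + y) (sym (edge-row v≢b d))
          (cong₂ (λ x y → u * x + y) (sym (edge-row v≢c d)) (sym (total-avoiding q W avoids refl d)))))
      (zero-total (∈-columns (v , d)))
    cramer-u : ∀ s t u ax ay bx by cx cy →
      ((bx - ax) * (cy - ay) - (by - ay) * (cx - ax)) * u ≡
      (ax - bx) * (s * ((ay + ay - by) - ay) + (t * ((ay + ay - by) - by) + (u * ((ay + ay - by) - cy) + 0ℚ)))
      - (ay - by) * (s * ((ax + ax - bx) - ax) + (t * ((ax + ax - bx) - bx) + (u * ((ax + ax - bx) - cx) + 0ℚ)))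
    cramer-u = solve-∀ ℚ-ring
    cramer-st : ∀ s t u ax ay bx by cx cy →
      ((bx - ax) * (cy - ay) - (by - ay) * (cx - ax)) * (s + (t + t)) ≡
      (s * ((ax + ax - bx) - ax) + (t * ((ax + ax - bx) - bx) + (u * ((ax + ax - bx) - cx) + 0ℚ))) * (ay - cy)
      - (s * ((ay + ay - by) - ay) + (t * ((ay + ay - by) - by) + (u * ((ay + ay - by) - cy) + 0ℚ))) * (ax - cx)
      - u * ((ax - bx) * (ay - cy) - (ay - by) * (ax - cx))
    cramer-st = solve-∀ ℚ-ring
    vanish-u : ∀ x y → x * 0ℚ - y * 0ℚ ≡ 0ℚ
    vanish-u = solve-∀ ℚ-ring
    vanish-st : ∀ x y z → 0ℚ * x - 0ℚ * y - 0ℚ * z ≡ 0ℚ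
    vanish-st = solve-∀ ℚ-ring
    u≡0 : u ≡ 0ℚ
    u≡0 = *-nonzero-cancelˡ area≢0 (trans
      (cramer-u s t u (p a x-axis) (p a y-axis) (p b x-axis) (p b y-axis) (p c x-axis) (p c y-axis))
      (trans (cong₂ (λ x y → (p a x-axis - p b x-axis) * y - (p a y-axis - p b y-axis) * x)
               (at-v x-axis) (at-v y-axis))
        (vanish-u (p a x-axis - p b x-axis) (p a y-axis - p b y-axis))))
    s+2t≡0 : s + (t + t) ≡ 0ℚ
    s+2t≡0 = *-nonzero-cancelˡ area≢0 (trans
      (cramer-st s t u (p a x-axis) (p a y-axis) (p b x-axis) (p b y-axis) (p c x-axis) (p c y-axis))
      (trans (cong₂ (λ x y → x * (p a y-axis - p c y-axis) - y * (p a x-axis - p c x-axis)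
                           - u * ((p a x-axis - p b x-axis) * (p a y-axis - p c y-axis)
                                - (p a y-axis - p b y-axis) * (p a x-axis - p c x-axis)))
               (at-v x-axis) (at-v y-axis))
        (trans (cong (λ z → 0ℚ * (p a y-axis - p c y-axis) - 0ℚ * (p a x-axis - p c x-axis)
                          - z * ((p a x-axis - p b x-axis) * (p a y-axis - p c y-axis)
                               - (p a y-axis - p b y-axis) * (p a x-axis - p c x-axis))) u≡0)
          (vanish-st (p a y-axis - p c y-axis) (p a x-axis - p c x-axis)
            ((p a x-axis - p b x-axis) * (p a y-axis - p c y-axis) - (p a y-axis - p b y-axis) * (p a x-axis - p c x-axis))))))
    local : ∀ d → total (row q) W d ≡ total (row p) W d
    local = total-local (λ {w} w∈ → reflected-≢ p (SubP.x∉⁅y⁆⇒x≢y (SubP.x∈∁p⇒x∉p w∈))) W avoids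
    spoke : ∀ {x w} → v ≢ x → w ≢ v → ∀ d →
      row q (v , x) (w , d) ≡ at x w 1ℚ * (p x d - (p a d + p a d - p b d))
    spoke {x} {w} v≢x w≢v d = begin
      at v w (q v d - q x d) + at x w (q x d - q v d)   ≡⟨ cong₂ _+_ (at-≢ _ w≢v) (at-linear x w _) ⟩
      0ℚ + at x w 1ℚ * (q x d - q v d)                  ≡⟨ ℚP.+-identityˡ _ ⟩
      at x w 1ℚ * (q x d - q v d)                       ≡⟨ cong (at x w 1ℚ *_)
        (cong₂ _-_ (reflected-≢ p (v≢x ∘ sym) d) (reflected-≡ p v d)) ⟩
      at x w 1ℚ * (p x d - (p a d + p a d - p b d))     ∎
    transfer : ∀ s t u i j y ax bx T →
      (t + t) * (i * (ax - bx) + j * (bx - ax)) + T ≡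
      s * (i * (ax - (ax + ax - bx))) + (t * (j * (bx - (ax + ax - bx))) + (u * y + T))
      + ((s + (t + t)) * (i * (ax - bx)) - u * y)
    transfer = solve-∀ ℚ-ring
    vanish-transfer : ∀ x y → 0ℚ + (0ℚ * x - 0ℚ * y) ≡ 0ℚ
    vanish-transfer = solve-∀ ℚ-ring
    zero-total′ : ∀ w d → (t + t) * row p (a , b) (w , d) + total (row p) W (w , d) ≡ 0ℚ
    zero-total′ w d with w FinP.≟ v
    ... | yes refl = trans (cong₂ (λ x y → (t + t) * x + y) (row-outside p d v≢a v≢b) (total-avoiding p W avoids refl d))
                       (trans (ℚP.+-identityʳ _) (ℚP.*-zeroʳ (t + t)))
    ... | no w≢v = begin
      (t + t) * row p (a , b) (w , d) + total (row p) W (w , d)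
        ≡⟨ cong (λ x → (t + t) * x + total (row p) W (w , d)) (cong₂ _+_ (at-linear a w _) (at-linear b w _)) ⟩
      (t + t) * (at a w 1ℚ * (p a d - p b d) + at b w 1ℚ * (p b d - p a d)) + total (row p) W (w , d)
        ≡⟨ transfer s t u (at a w 1ℚ) (at b w 1ℚ) (row q (v , c) (w , d)) (p a d) (p b d) (total (row p) W (w , d)) ⟩
      s * (at a w 1ℚ * (p a d - (p a d + p a d - p b d)))
      + (t * (at b w 1ℚ * (p b d - (p a d + p a d - p b d))) + (u * row q (v , c) (w , d) + total (row p) W (w , d)))
      + ((s + (t + t)) * (at a w 1ℚ * (p a d - p b d)) - u * row q (v , c) (w , d))
        ≡⟨ cong₂ _+_
             (trans (cong₂ (λ x y → s * x + y) (sym (spoke v≢a w≢v d))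
                      (cong₂ (λ x y → t * x + (u * row q (v , c) (w , d) + y)) (sym (spoke v≢b w≢v d)) (sym (local (w , d)))))
                    (zero-total (∈-columns (w , d))))
             (cong₂ (λ x y → x * (at a w 1ℚ * (p a d - p b d)) - y * row q (v , c) (w , d)) s+2t≡0 u≡0) ⟩
      0ℚ + (0ℚ * (at a w 1ℚ * (p a d - p b d)) - 0ℚ * row q (v , c) (w , d))
        ≡⟨ vanish-transfer (at a w 1ℚ * (p a d - p b d)) (row q (v , c) (w , d)) ⟩
      0ℚ ∎
    free-weights : All (λ w → proj₁ w ≡ 0ℚ) ((t + t , (a , b)) ∷ W)
    free-weights = free ((t + t , (a , b)) ∷ W) refl λ {c} _ → zero-total′ (proj₁ c) (proj₂ c)
    2t≡0 : t + t ≡ 0ℚ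
    2t≡0 = All.head free-weights
    half : ∀ t → (1ℚ + 1ℚ) * t ≡ t + t
    half = solve-∀ ℚ-ring
    t≡0 : t ≡ 0ℚ
    t≡0 = *-nonzero-cancelˡ {1ℚ + 1ℚ} (λ ()) (trans (half t) 2t≡0)
    s≡0 : s ≡ 0ℚ
    s≡0 = trans (sym (ℚP.+-identityʳ s)) (trans (cong (s +_) (sym 2t≡0)) s+2t≡0)

  Realizable : List (Edge n) → Set
  Realizable E = ∃ λ p → StressFree p E

  realizable-↭ : ∀ {E F : List (Edge n)} → E ↭ F → Realizable F → Realizable E
  realizable-↭ E↭F (p , free) = p , independent-↭ {r = row p} E↭F free

  extend₁ : ∀ {v a} {E : List (Edge n)} → Avoids v E → v ≢ a → Realizable E → Realizable ((v , a) ∷ E)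
  extend₁ avoids v≢a (p , free) =
    let q , free′ , d≢0 = generic (displacement-observable v≢a) {p} free
    in q , attach₁ {p = q} avoids v≢a d≢0 free′

  extend₂ : ∀ {v a b} {E : List (Edge n)} → Avoids v E → v ≢ a → v ≢ b → a ≢ b →
    Realizable E → Realizable ((v , a) ∷ (v , b) ∷ E)
  extend₂ avoids v≢a v≢b a≢b (p , free) =
    let q , free′ , area≢0 = generic (area-observable v≢a v≢b a≢b) {p} free
    in q , attach₂ {p = q} avoids v≢a v≢b area≢0 free′

  extend₃ : ∀ {v a b c} {E : List (Edge n)} → Avoids v E → v ≢ a → v ≢ b → v ≢ c → a ≢ b → a ≢ c → b ≢ c →
    Realizable ((a , b) ∷ E) → Realizable ((v , a) ∷ (v , b) ∷ (v , c) ∷ E)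
  extend₃ {v = v} {a} {b} avoids v≢a v≢b v≢c a≢b a≢c b≢c (p , free) =
    let q , free′ , area≢0 = generic (area-observable a≢b a≢c b≢c) {p} free
    in reflected q v a b , attach₃ {p = q} avoids v≢a v≢b v≢c area≢0 free′

  row-orient : ∀ (p : Placement* n) v e c → row p (orient v e) c ≡ row p e c
  row-orient p v (a , b) (w , c) with does (v FinP.≟ b)
  ... | true  = ℚP.+-comm (at b w (p b c - p a c)) (at a w (p a c - p b c))
  ... | false = refl

  -- The inductive step, with `smaller` as the hypothesis. One or two edges at `v` are deleted;
  -- three are traded for one new edge between neighbours, which still lowers the number of edges.
  realizable-star : ∀ {n} {v : Fin n} us (E : List (Edge n)) → Avoids v E → Laman (map (v ,_) us ++ E) →
    1 ℕ.≤ length us → length us ℕ.≤ 3 →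
    (∀ (F : List (Edge n)) → length F ℕ.< length us ℕ.+ length E → Laman F → Realizable F) → Realizable (map (v ,_) us ++ E)
  realizable-star (a ∷ []) E avoids laman _ _ smaller =
    extend₁ avoids (no-loop laman) (smaller E (ℕP.n<1+n _) (Laman-tail laman))
  realizable-star (a ∷ b ∷ []) E avoids laman _ _ smaller =
    extend₂ avoids (no-loop laman) (no-loop (Laman-tail laman)) (no-parallel laman)
      (smaller E (ℕP.m≤n+m _ 1) (Laman-tail (Laman-tail laman)))
  realizable-star {v = v} (a ∷ b ∷ c ∷ []) E avoids laman _ _ smaller
    = reduce (DegreeThree.reducible laman)
    where
    v≢a : v ≢ a
    v≢a = no-loop laman
    v≢b : v ≢ b
    v≢b = no-loop (Laman-tail laman)
    v≢c : v ≢ c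
    v≢c = no-loop (Laman-tail (Laman-tail laman))
    a≢b : a ≢ b
    a≢b = no-parallel laman
    b≢c : b ≢ c
    b≢c = no-parallel (Laman-tail laman)
    a≢c : a ≢ c
    a≢c = DegreeThree.a≢c laman
    -- `extend₃` expects the new edge between the first two neighbours; cyclic rotation brings the
    -- other two pairs there.
    rotated : ∀ {x y z : Edge _} → z ∷ x ∷ y ∷ E ↭ x ∷ y ∷ z ∷ E
    rotated = Perm.trans (Perm.swap _ _ Perm.refl) (Perm.prep _ (Perm.swap _ _ Perm.refl))
    realize : ∀ e → Laman (e ∷ E) → Realizable (e ∷ E)
    realize e = smaller (e ∷ E) (ℕP.m≤n+m _ 1)
    reduce : Laman ((a , b) ∷ E) ⊎ Laman ((b , c) ∷ E) ⊎ Laman ((c , a) ∷ E) →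
      Realizable ((v , a) ∷ (v , b) ∷ (v , c) ∷ E)
    reduce (inj₁ ab) = extend₃ avoids v≢a v≢b v≢c a≢b a≢c b≢c (realize _ ab)
    reduce (inj₂ (inj₁ bc)) =
      realizable-↭ rotated (extend₃ avoids v≢b v≢c v≢a b≢c (a≢b ∘ sym) (a≢c ∘ sym) (realize _ bc))
    reduce (inj₂ (inj₂ ca)) =
      realizable-↭ (↭-sym rotated) (extend₃ avoids v≢c v≢a v≢b (a≢c ∘ sym) (b≢c ∘ sym) a≢b (realize _ ca))
  realizable-star (_ ∷ _ ∷ _ ∷ _ ∷ _) E avoids laman _ (ℕ.s≤s (ℕ.s≤s (ℕ.s≤s ()))) smaller

  -- The recursion is on a bound `k` for the length, since the lists it meets are not sublists of
  -- `E`: edges have been reoriented, permuted and perhaps inserted.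
  laman⇒realizable : ∀ k (E : List (Edge n)) → length E ℕ.≤ k → Laman E → Realizable E
  laman⇒realizable k [] _ laman = (λ _ _ → 0ℚ) , λ { [] _ _ → [] }
  laman⇒realizable {n} (suc k) E@(_ ∷ _) len≤ laman =
    let v , low , high = low-degree (ℕ.s≤s ℕ.z≤n) laman
        us , E′ , avoids , perm , us≤ , ≤us = star v E
        p , free = realizable-↭ perm
          (realizable-star us E′ avoids
            (Laman-resp {E = E} (λ X → trans (sym (induced-orient v X E)) (induced-↭ X perm)) laman)
            (nonempty (ℕP.≤-trans low ≤us)) (ℕP.≤-trans us≤ high)
            (λ F F< → laman⇒realizable k F (ℕP.≤-pred (ℕP.≤-trans F< (ℕP.≤-trans (ℕP.≤-reflexive (lengths v us E′ perm)) len≤)))))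
    in p , independent-cong {r = λ e → row p (orient v e)} (row-orient p v) (independent-map⁻ {r = row p} free)
    where
    nonempty : ∀ {j} → 1 ℕ.≤ 2 ℕ.* j → 1 ℕ.≤ j
    nonempty {suc j} _ = ℕ.s≤s ℕ.z≤n
    lengths : ∀ v us E′ → map (orient v) E ↭ map (v ,_) us ++ E′ → length us ℕ.+ length E′ ≡ length E
    lengths v us E′ perm = begin
      length us ℕ.+ length E′                  ≡⟨ cong (ℕ._+ length E′) (length-map (v ,_) us) ⟨
      length (map (v ,_) us) ℕ.+ length E′     ≡⟨ length-++ (map (v ,_) us) ⟨
      length (map (v ,_) us ++ E′)             ≡⟨ PermP.↭-length perm ⟨
      length (map (orient v) E)                ≡⟨ length-map (orient v) E ⟩
      length E                                 ∎

-- Finite subsets and transversals.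

module SubsetLemmas where
  open import Data.Nat.Base using (_+_; _∸_; _≤_; _<_; z≤n; s≤s)

  private
    variable
      n : ℕ

  ⊆-or-witness : ∀ (P Q : Subset n) → P ⊆ Q ⊎ ∃ λ x → x Sub.∈ P × x Sub.∉ Q
  ⊆-or-witness P Q with FinP.any? (λ x → (x SubP.∈? P) ×-dec ¬? (x SubP.∈? Q))
  ... | yes witness = inj₂ witness
  ... | no none     = inj₁ λ {x} x∈P → decidable-stable (x SubP.∈? Q) λ x∉Q → none (x , x∈P , x∉Q)

  1≤∣∣⇒nonempty : ∀ (P : Subset n) → 1 ≤ ∣ P ∣ → Sub.Nonempty P
  1≤∣∣⇒nonempty {n} P 1≤ with SubP.nonempty? P
  ... | yes nonempty = nonempty
  ... | no empty     = ⊥-elim (ℕP.n≮n 0 (subst (1 ≤_) (trans (cong ∣_∣ (SubP.Empty-unique empty)) (SubP.∣⊥∣≡0 n)) 1≤))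

  ∣∣+∣∁∣ : ∀ (P : Subset n) → ∣ P ∣ + ∣ ∁ P ∣ ≡ n
  ∣∣+∣∁∣ P = trans (cong (∣ P ∣ +_) (SubP.∣∁p∣≡n∸∣p∣ P)) (ℕP.m+[n∸m]≡n (SubP.∣p∣≤n P))

  subsets : ∀ n → List (Subset n)
  subsets zero    = Vec.[] ∷ []
  subsets (suc n) = map (true Vec.∷_) (subsets n) ++ map (false Vec.∷_) (subsets n)

  ∈-subsets : ∀ (P : Subset n) → P ∈ subsets n
  ∈-subsets Vec.[]          = here refl
  ∈-subsets (true  Vec.∷ P) = ∈-++⁺ˡ (∈-map⁺ _ (∈-subsets P))
  ∈-subsets (false Vec.∷ P) = ∈-++⁺ʳ _ (∈-map⁺ _ (∈-subsets P))

  subsets-unique : ∀ n → Unique (subsets n)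
  subsets-unique zero    = [] ∷ []
  subsets-unique (suc n) = UniqueP.++⁺
    (UniqueP.map⁺ VecP.∷-injectiveʳ (subsets-unique n))
    (UniqueP.map⁺ VecP.∷-injectiveʳ (subsets-unique n))
    λ (P∈ , P∈′) → disjoint (∈-map⁻ _ P∈) (∈-map⁻ _ P∈′)
    where
    disjoint : ∀ {P} → ∃ (λ Q → Q ∈ subsets n × P ≡ true Vec.∷ Q) → ∃ (λ Q → Q ∈ subsets n × P ≡ false Vec.∷ Q) → ⊥
    disjoint (_ , _ , refl) (_ , _ , ())

  fromList : List (Fin n) → Subset n
  fromList []       = Sub.⊥
  fromList (x ∷ xs) = ⁅ x ⁆ ∪ fromList xs

  ∈-fromList : ∀ {xs} {x : Fin n} → x ∈ xs → x Sub.∈ fromList xs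
  ∈-fromList {xs = y ∷ xs} (here refl) = SubP.p⊆p∪q (fromList xs) (SubP.x∈⁅x⁆ y)
  ∈-fromList {xs = y ∷ xs} (there x∈)  = SubP.q⊆p∪q ⁅ y ⁆ (fromList xs) (∈-fromList x∈)

  ∣fromList∣≤ : ∀ (xs : List (Fin n)) → ∣ fromList xs ∣ ≤ length xs
  ∣fromList∣≤ {n} []   = ℕP.≤-reflexive (SubP.∣⊥∣≡0 n)
  ∣fromList∣≤ (x ∷ xs) = ℕP.≤-trans (Sparsity.∣∪∣≤ ⁅ x ⁆ (fromList xs))
    (ℕP.+-mono-≤ (ℕP.≤-reflexive (SubP.∣⁅x⁆∣≡1 x)) (∣fromList∣≤ xs))

  unique-length≤ : ∀ {xs : List (Fin n)} {P : Subset n} → Unique xs → All (Sub._∈ P) xs → length xs ≤ ∣ P ∣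
  unique-length≤ []             []            = z≤n
  unique-length≤ (x∉xs ∷ unique) (x∈P ∷ xs⊆P) =
    ℕP.≤-trans (s≤s (unique-length≤ unique
      (All.zipWith (λ (x≢y , y∈P) → SubP.x∈p∧x≢y⇒x∈p-y y∈P (x≢y ∘ sym)) (x∉xs , xs⊆P))))
      (SubP.x∈p⇒∣p-x∣<∣p∣ x∈P)

  -- Disjointness makes the elements chosen from different members distinct, which turns the choice
  -- into a count of `L`. `Q` allows the choice to be restricted, as when the elements must avoid a
  -- given independent set.
  transversal : ∀ (L : List (Subset n)) {Q : Fin n → Set} → Unique L →
    (∀ {C D e} → C ∈ L → D ∈ L → C ≢ D → e Sub.∈ C → e Sub.∉ D) →
    (∀ {C} → C ∈ L → ∃ λ e → e Sub.∈ C × Q e) →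
    ∃ λ us → length us ≡ length L × Unique us × All Q us ×
      All (λ e → ∃ λ C → C ∈ L × e Sub.∈ C) us × (∀ {C} → C ∈ L → ∃ λ e → e ∈ us × e Sub.∈ C)
  transversal []      []              disjoint choose = [] , refl , [] , [] , [] , λ ()
  transversal (C ∷ L) (C∉L ∷ unique) disjoint choose
    with us , len , us-unique , Qs , sources , hits ← transversal L unique
           (λ C∈ D∈ → disjoint (there C∈) (there D∈)) (choose ∘ there)
       | e , e∈C , Qe ← choose (here refl) =
    e ∷ us , cong suc len , All.map new sources ∷ us-unique , Qe ∷ Qs ,
    (C , here refl , e∈C) ∷ All.map (λ (D , D∈ , x∈D) → D , there D∈ , x∈D) sources ,
    λ { (here refl) → e , here refl , e∈C
      ; (there D∈)  → let x , x∈us , x∈D = hits D∈ in x , there x∈us , x∈D }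
    where
    new : ∀ {x} → ∃ (λ D → D ∈ L × x Sub.∈ D) → e ≢ x
    new (D , D∈ , x∈D) refl = disjoint (here refl) (there D∈) (All.lookup C∉L D∈) e∈C x∈D

-- Circuits and rank, from the sparsity counts alone.

module Circuits {m n : ℕ} (span : Subset n → Subset m)
  (span-mono : ∀ {X Y} → X ⊆ Y → span X ⊆ span Y)
  (span-∩ : ∀ {X Y e} → e Sub.∈ span X → e Sub.∈ span Y → e Sub.∈ span (X ∩ Y))
  (span-bound : ∀ X → 1 ℕ.≤ ∣ span X ∣ → ∣ span X ∣ ℕ.+ 2 ℕ.≤ 2 ℕ.* ∣ X ∣)
  (Indep : Subset m → Set)
  (indep⇒sparse : ∀ {S} → Indep S → ∀ X → 1 ℕ.≤ ∣ S ∩ span X ∣ → ∣ S ∩ span X ∣ ℕ.+ 3 ℕ.≤ 2 ℕ.* ∣ X ∣)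
  (sparse⇒indep : ∀ {S} → (∀ X → 1 ℕ.≤ ∣ S ∩ span X ∣ → ∣ S ∩ span X ∣ ℕ.+ 3 ℕ.≤ 2 ℕ.* ∣ X ∣) → Indep S)
  where
  open import Data.Nat.Base using (_+_; _*_; _≤_; _<_; z≤n; s≤s)
  open SubsetLemmas
  open Sparsity using (∣∪∣+∣∩∣; 1≤∣∣)

  Circuit : Subset m → Set
  Circuit C = ¬ Indep C × (∀ F → F ⊂ C → Indep F)

  -- Failure of sparsity at `X`, with a strict bound below `+ 3` turned into `+ 2`. Together with
  -- `span-bound` it says that `S ∩ span X` has exactly 2|X| - 2 elements.
  Violates : Subset m → Subset n → Set
  Violates S X = 1 ≤ ∣ S ∩ span X ∣ × 2 * ∣ X ∣ ≤ ∣ S ∩ span X ∣ + 2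

  violated⇒dependent : ∀ {S X} → Violates S X → ¬ Indep S
  violated⇒dependent {S} {X} (nonempty , big) indep = ℕP.1+n≰n (begin
    suc (∣ S ∩ span X ∣ + 2)    ≡⟨ ℕP.+-suc _ 2 ⟨
    ∣ S ∩ span X ∣ + 3          ≤⟨ indep⇒sparse indep X nonempty ⟩
    2 * ∣ X ∣                   ≤⟨ big ⟩
    ∣ S ∩ span X ∣ + 2          ∎)
    where open ℕP.≤-Reasoning

  -- For rigidity, `Indep` asserts that a placement exists, which cannot be searched for; its
  -- sparsity form concerns finitely many `X` and is decidable.
  indep-or-violated : ∀ S → Indep S ⊎ ∃ (Violates S)
  indep-or-violated S
    with SubP.anySubset? (λ X → (1 ℕP.≤? ∣ S ∩ span X ∣) ×-dec (2 * ∣ X ∣ ℕP.≤? ∣ S ∩ span X ∣ + 2))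
  ... | yes violated  = inj₂ violated
  ... | no ¬violated = inj₁ (sparse⇒indep λ X nonempty →
          subst (_≤ 2 * ∣ X ∣) (sym (ℕP.+-suc _ 2)) (ℕP.≰⇒> λ big → ¬violated (X , nonempty , big)))

  indep? : ∀ S → Dec (Indep S)
  indep? S with indep-or-violated S
  ... | inj₁ indep          = yes indep
  ... | inj₂ (_ , violates) = no (violated⇒dependent violates)

  dependent-or-minimal : ∀ S → (∃ λ F → F ⊂ S × ¬ Indep F) ⊎ (∀ F → F ⊂ S → Indep F)
  dependent-or-minimal S with SubP.anySubset? (λ F → (F SubP.⊂? S) ×-dec ¬? (indep? F))
  ... | yes found = inj₁ found
  ... | no ¬found = inj₂ λ F F⊂S → decidable-stable (indep? F) λ dependent → ¬found (F , F⊂S , dependent)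

  circuit? : ∀ C → Dec (Circuit C)
  circuit? C with indep? C | dependent-or-minimal C
  ... | yes indep    | _                          = no λ (dependent , _) → dependent indep
  ... | no _         | inj₁ (F , F⊂C , dependent) = no λ (_ , minimal) → dependent (minimal F F⊂C)
  ... | no dependent | inj₂ minimal               = yes (dependent , minimal)

  contains-circuit : ∀ S → ¬ Indep S → ∃ λ C → C ⊆ S × Circuit C
  contains-circuit S = search S (SubI.⊂-wellFounded S)
    where
    search : ∀ S → SubI.Acc _⊂_ S → ¬ Indep S → ∃ λ C → C ⊆ S × Circuit C
    search S (SubI.acc smaller) dependent with dependent-or-minimal S
    ... | inj₂ minimal = S , id , dependent , minimal
    ... | inj₁ (F , F⊂S@(F⊆S , _) , F-dependent)
      with C , C⊆F , circuit ← search F (smaller F⊂S) F-dependent = C , (λ {x} x∈C → F⊆S (C⊆F x∈C)) , circuit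

  -- If `X` violates sparsity for `C`, it already does so for `C ∩ span X`. That part is dependent,
  -- so by minimality it is all of `C`.
  circuit-tight : ∀ {C} → Circuit C → ∃ λ X → C ⊆ span X × 2 * ∣ X ∣ ≤ ∣ C ∣ + 2
  circuit-tight {C} (dependent , minimal) with indep-or-violated C
  ... | inj₁ indep = ⊥-elim (dependent indep)
  ... | inj₂ (X , nonempty , big) =
    X , (λ {x} → spanned {x}) , ℕP.≤-trans big (ℕP.+-monoˡ-≤ 2 (SubP.∣p∩q∣≤∣p∣ C (span X)))
    where
    F : Subset m
    F = C ∩ span X
    restricted : ∣ C ∩ span X ∣ ≤ ∣ F ∩ span X ∣
    restricted = SubP.p⊆q⇒∣p∣≤∣q∣ λ e∈F → SubP.x∈p∩q⁺ (e∈F , SubP.p∩q⊆q C (span X) e∈F)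
    F-dependent : ¬ Indep F
    F-dependent = violated⇒dependent {X = X}
      (ℕP.≤-trans nonempty restricted , ℕP.≤-trans big (ℕP.+-monoˡ-≤ 2 restricted))
    spanned : C ⊆ span X
    spanned {e} e∈C = decidable-stable (e SubP.∈? span X) λ e∉ →
      F-dependent (minimal F (SubP.p∩q⊆p C (span X) , e , e∈C , λ e∈F → e∉ (SubP.p∩q⊆q C (span X) e∈F)))

  -- Tightness gives |C| + |D| ≥ 2|X| + 2|Y| - 4. If the circuits met, the intersection would be
  -- independent with at most 2|X ∩ Y| - 3 elements, while the union has at most 2|X ∪ Y| - 2;
  -- together these give |C| + |D| ≤ 2|X| + 2|Y| - 5.
  circuits-disjoint : ∀ {C D e} → Circuit C → Circuit D → C ≢ D → e Sub.∈ C → e Sub.∉ D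
  circuits-disjoint {C} {D} {e} circuit-C circuit-D C≢D e∈C e∈D
    with X , C⊆ , tight-C ← circuit-tight circuit-C | Y , D⊆ , tight-D ← circuit-tight circuit-D = ℕP.1+n≰n (begin
      suc (2 * ∣ X ∣ + 2 * ∣ Y ∣)                 ≤⟨ s≤s (ℕP.+-mono-≤ tight-C tight-D) ⟩
      suc ((∣ C ∣ + 2) + (∣ D ∣ + 2))             ≡⟨ regroup (∣ C ∣) (∣ D ∣) ⟩
      (∣ C ∣ + ∣ D ∣) + 5                         ≡⟨ cong (_+ 5) (∣∪∣+∣∩∣ C D) ⟨
      (∣ C ∪ D ∣ + ∣ C ∩ D ∣) + 5                 ≡⟨ regroup′ (∣ C ∪ D ∣) (∣ C ∩ D ∣) ⟩
      (∣ C ∪ D ∣ + 2) + (∣ C ∩ D ∣ + 3)           ≤⟨ ℕP.+-mono-≤ (union-bound X Y C⊆ D⊆) (meet-bound X Y C⊆ D⊆) ⟩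
      2 * ∣ X ∪ Y ∣ + 2 * ∣ X ∩ Y ∣               ≡⟨ ℕP.*-distribˡ-+ 2 (∣ X ∪ Y ∣) (∣ X ∩ Y ∣) ⟨
      2 * (∣ X ∪ Y ∣ + ∣ X ∩ Y ∣)                 ≡⟨ cong (2 *_) (∣∪∣+∣∩∣ X Y) ⟩
      2 * (∣ X ∣ + ∣ Y ∣)                         ≡⟨ ℕP.*-distribˡ-+ 2 (∣ X ∣) (∣ Y ∣) ⟩
      2 * ∣ X ∣ + 2 * ∣ Y ∣                       ∎)
    where
    open ℕP.≤-Reasoning
    regroup : ∀ c d → suc ((c + 2) + (d + 2)) ≡ (c + d) + 5
    regroup = ℕSolver.solve-∀
    regroup′ : ∀ u j → (u + j) + 5 ≡ (u + 2) + (j + 3)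
    regroup′ = ℕSolver.solve-∀
    -- By minimality neither of two distinct circuits contains the other, so the intersection is a
    -- proper subset of `C`.
    J-indep : Indep (C ∩ D)
    J-indep with ⊆-or-witness C D | ⊆-or-witness D C
    ... | inj₂ (x , x∈C , x∉D) | _ =
      proj₂ circuit-C (C ∩ D) (SubP.p∩q⊆p C D , x , x∈C , λ x∈J → x∉D (SubP.p∩q⊆q C D x∈J))
    ... | inj₁ C⊆D | inj₁ D⊆C = ⊥-elim (C≢D (SubP.⊆-antisym C⊆D D⊆C))
    ... | inj₁ C⊆D | inj₂ x   = ⊥-elim (proj₁ circuit-C (proj₂ circuit-D C (C⊆D , x)))
    meet-bound : ∀ X Y → C ⊆ span X → D ⊆ span Y → ∣ C ∩ D ∣ + 3 ≤ 2 * ∣ X ∩ Y ∣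
    meet-bound X Y C⊆ D⊆ = ℕP.≤-trans (ℕP.+-monoˡ-≤ 3 all-spanned)
      (indep⇒sparse J-indep (X ∩ Y) (ℕP.≤-trans (1≤∣∣ (SubP.x∈p∩q⁺ (e∈C , e∈D))) all-spanned))
      where
      all-spanned : ∣ C ∩ D ∣ ≤ ∣ (C ∩ D) ∩ span (X ∩ Y) ∣
      all-spanned = SubP.p⊆q⇒∣p∣≤∣q∣ λ x∈J →
        SubP.x∈p∩q⁺ (x∈J , span-∩ (C⊆ (SubP.p∩q⊆p C D x∈J)) (D⊆ (SubP.p∩q⊆q C D x∈J)))
    union-bound : ∀ X Y → C ⊆ span X → D ⊆ span Y → ∣ C ∪ D ∣ + 2 ≤ 2 * ∣ X ∪ Y ∣
    union-bound X Y C⊆ D⊆ = ℕP.≤-trans (ℕP.+-monoˡ-≤ 2 all-spanned)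
      (span-bound (X ∪ Y) (ℕP.≤-trans (1≤∣∣ (SubP.p⊆p∪q D e∈C)) all-spanned))
      where
      member : ∀ {x} → x Sub.∈ C ⊎ x Sub.∈ D → x Sub.∈ span (X ∪ Y)
      member (inj₁ x∈C) = span-mono (SubP.p⊆p∪q Y) (C⊆ x∈C)
      member (inj₂ x∈D) = span-mono (SubP.q⊆p∪q X Y) (D⊆ x∈D)
      all-spanned : ∣ C ∪ D ∣ ≤ ∣ span (X ∪ Y) ∣
      all-spanned = SubP.p⊆q⇒∣p∣≤∣q∣ (member ∘ SubP.x∈p∪q⁻ C D)

  circuits : List (Subset m)
  circuits = filter circuit? (subsets m)

  circuits-unique : Unique circuits
  circuits-unique = UniqueP.filter⁺ circuit? (subsets-unique m)

  ∈-circuits⁺ : ∀ {C} → Circuit C → C ∈ circuits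
  ∈-circuits⁺ {C} = ∈-filter⁺ circuit? (∈-subsets C)

  ∈-circuits⁻ : ∀ {C} → C ∈ circuits → Circuit C
  ∈-circuits⁻ = proj₂ ∘ ∈-filter⁻ circuit? {xs = subsets m}

  distinct-disjoint : ∀ {C D e} → C ∈ circuits → D ∈ circuits → C ≢ D → e Sub.∈ C → e Sub.∉ D
  distinct-disjoint C∈ D∈ = circuits-disjoint (∈-circuits⁻ C∈) (∈-circuits⁻ D∈)

  indep-⊆ : ∀ {F S} → F ⊆ S → Indep S → Indep F
  indep-⊆ {F} {S} F⊆S indep with indep-or-violated F
  ... | inj₁ F-indep = F-indep
  ... | inj₂ (X , nonempty , big) =
    ⊥-elim (violated⇒dependent {X = X} (ℕP.≤-trans nonempty grow , ℕP.≤-trans big (ℕP.+-monoˡ-≤ 2 grow)) indep)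
    where
    grow : ∣ F ∩ span X ∣ ≤ ∣ S ∩ span X ∣
    grow = SubP.p⊆q⇒∣p∣≤∣q∣ λ e∈ →
      SubP.x∈p∩q⁺ (F⊆S (SubP.p∩q⊆p F (span X) e∈) , SubP.p∩q⊆q F (span X) e∈)

  -- No circuit lies inside `T`, so each has an element outside `T`; disjointness makes these
  -- distinct, so the complement of `T` is at least as large as the number of circuits.
  indep-bound : ∀ {T} → Indep T → ∣ T ∣ + length circuits ≤ m
  indep-bound {T} T-indep =
    let us , len , us-unique , missed , _ = transversal circuits circuits-unique distinct-disjoint outside
    in ℕP.≤-trans
         (ℕP.+-monoʳ-≤ (∣ T ∣) (subst (_≤ ∣ ∁ T ∣) len (unique-length≤ us-unique (All.map SubP.x∉p⇒x∈∁p missed))))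
         (ℕP.≤-reflexive (∣∣+∣∁∣ T))
    where
    outside : ∀ {C} → C ∈ circuits → ∃ λ e → e Sub.∈ C × e Sub.∉ T
    outside {C} C∈ with ⊆-or-witness C T
    ... | inj₁ C⊆T     = ⊥-elim (proj₁ (∈-circuits⁻ C∈) (indep-⊆ C⊆T T-indep))
    ... | inj₂ witness = witness

  -- Removing a transversal of the circuits leaves a set that contains no circuit and is therefore
  -- independent, at a cost of at most one element per circuit.
  rank-witness : ∃ λ S → Indep S × m ≤ ∣ S ∣ + length circuits
  rank-witness =
    let us , len , _ , _ , _ , hits = transversal circuits {λ _ → Unit} circuits-unique distinct-disjoint nonempty
    in ∁ (fromList us)
     , decidable-stable (indep? _) (λ dependent →
         let C , C⊆ , circuit = contains-circuit _ dependent
             e , e∈us , e∈C = hits (∈-circuits⁺ circuit)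
         in SubP.x∈∁p⇒x∉p (C⊆ e∈C) (∈-fromList e∈us))
     , (begin
         m                                               ≡⟨ ∣∣+∣∁∣ (fromList us) ⟨
         ∣ fromList us ∣ + ∣ ∁ (fromList us) ∣           ≤⟨ ℕP.+-monoˡ-≤ _ (ℕP.≤-trans (∣fromList∣≤ us) (ℕP.≤-reflexive len)) ⟩
         length circuits + ∣ ∁ (fromList us) ∣           ≡⟨ ℕP.+-comm (length circuits) _ ⟩
         ∣ ∁ (fromList us) ∣ + length circuits           ∎)
    where
    open ℕP.≤-Reasoning
    -- Rules out an empty circuit, from which no element could be chosen.
    empty-indep : Indep Sub.⊥
    empty-indep = sparse⇒indep λ X nonempty → ⊥-elim (ℕP.n≮n 0 (ℕP.≤-trans nonempty
      (ℕP.≤-trans (SubP.∣p∩q∣≤∣p∣ Sub.⊥ (span X)) (ℕP.≤-reflexive (SubP.∣⊥∣≡0 m)))))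
    nonempty : ∀ {C} → C ∈ circuits → ∃ λ e → e Sub.∈ C × Unit
    nonempty {C} C∈ with ⊆-or-witness C Sub.⊥
    ... | inj₁ C⊆⊥          = ⊥-elim (proj₁ (∈-circuits⁻ C∈) (indep-⊆ C⊆⊥ empty-indep))
    ... | inj₂ (e , e∈C , _) = e , e∈C , tt

-- The graph G* and the pinned framework conditions.

module IdentifiedGraph (G : PinnedGraph) where
  open ℚ using (ℚ; 0ℚ; _+_; _*_)
  open ≡-Reasoning
  open Sums
  open LinearIndependence
  open Selection
  open Rigidity
  open Sparsity using (from-does)
  open Henneberg using (laman⇒realizable)
  open SubsetLemmas using (1≤∣∣⇒nonempty)

  ends : Fin (m G) → Edge (suc (ni G))
  ends e = tail* G e , head* G e

  entries : Placement G → Fin (m G) → Column (suc (ni G)) → ℚ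
  entries p e (w , c) = entry G p e w c

  sumFin-select : ∀ {k} (S : Subset k) (f : Fin k → ℚ) →
    sumFin G (λ e → if Vec.lookup S e then f e else 0ℚ) ≡ ∑ (select S) f
  sumFin-select Vec.[]              f = refl
  sumFin-select (true  Vec.∷ S) f =
    cong (f zero +_) (trans (sumFin-select S (f ∘ suc)) (sym (∑-map (select S) suc f)))
  sumFin-select (false Vec.∷ S) f =
    trans (ℚP.+-identityˡ _) (trans (sumFin-select S (f ∘ suc)) (sym (∑-map (select S) suc f)))

  weighted : ∀ {k} → (Fin k → ℚ) → Subset k → Stress (Fin k)
  weighted ω S = map (λ e → ω e , e) (select S)

  total-weighted : ∀ p ω S w c →
    sumFin G (λ e → if Vec.lookup S e then ω e * entry G p e w c else 0ℚ) ≡ total (entries p) (weighted ω S) (w , c)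
  total-weighted p ω S w c = trans (sumFin-select S _) (sym (∑-map (select S) _ _))

  -- `IndepAt` ranges over coefficient functions, `LinIndep` over weighted lists. As `select S`
  -- lists each edge once, every weighting comes from a function; its value 0 outside `S` is an
  -- arbitrary default.
  weights : ∀ {k} (S : Subset k) (W : Stress (Fin k)) → map proj₂ W ≡ select S → ∃ λ ω → weighted ω S ≡ W
  weights Vec.[] [] eq = (λ ()) , refl
  weights (true Vec.∷ S) ((q , _) ∷ W) eq
    with refl ← ∷-injectiveˡ eq | W′ , eq′ , refl ← lift-stress suc (select S) W (∷-injectiveʳ eq)
    with ω , refl ← weights S W′ eq′ =
    (λ { zero → q ; (suc e) → ω e }) , cong ((q , zero) ∷_) (trans (sym (map-∘ (select S))) (map-∘ (select S)))
  weights (false Vec.∷ S) W eq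
    with W′ , eq′ , refl ← lift-stress suc (select S) W eq
    with ω , refl ← weights S W′ eq′ =
    (λ { zero → 0ℚ ; (suc e) → ω e }) , trans (sym (map-∘ (select S))) (map-∘ (select S))

  indepAt⇒linIndep : ∀ p S → IndepAt G p S → LinIndep columns (entries p) (select S)
  indepAt⇒linIndep p S indep W eq zero-total with ω , refl ← weights S W eq =
    AllP.map⁺ (All.tabulate λ {e} e∈ → indep ω
      (λ w c → trans (total-weighted p ω S w c) (zero-total (∈-columns (w , c))))
      e (VecP.[]=⇒lookup (∈-select⁻ {S = S} e∈)))

  linIndep⇒indepAt : ∀ p S → LinIndep columns (entries p) (select S) → IndepAt G p S
  linIndep⇒indepAt p S indep ω zero-total e e∈S = All.lookup (AllP.map⁻ vanishing) (∈-select⁺ (VecP.lookup⇒[]= e S e∈S))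
    where
    vanishing : All (λ w → proj₁ w ≡ 0ℚ) (weighted ω S)
    vanishing = indep (weighted ω S) (trans (sym (map-∘ (select S))) (map-id (select S)))
      λ {c} _ → trans (sym (total-weighted p ω S (proj₁ c) (proj₂ c))) (zero-total (proj₁ c) (proj₂ c))

  edges : Subset (m G) → List (Edge (suc (ni G)))
  edges S = map ends (select S)

  independent⇒Laman : ∀ S → Independent G S → Laman (edges S)
  independent⇒Laman S (p , indep) = stressFree⇒Laman (λ w → coord G (p w)) (edges S)
    (independent-map⁺ {r = row (λ w → coord G (p w))} (indepAt⇒linIndep p S indep))

  Laman⇒independent : ∀ S → Laman (edges S) → Independent G S
  Laman⇒independent S laman with q , free ← laman⇒realizable (length (edges S)) (edges S) ℕP.≤-refl laman =
    p , linIndep⇒indepAt p S (independent-map⁻ {r = row (λ w → coord G (p w))}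
          (independent-cong {r = row q} (Henneberg.row-cong coordinates≗) free))
    where
    p : Placement G
    p w = q w zero , q w (suc zero)
    coordinates≗ : ∀ w c → q w c ≡ coord G (p w) c
    coordinates≗ w zero       = refl
    coordinates≗ w (suc zero) = refl

  span : Subset (suc (ni G)) → Subset (m G)
  span X = Vec.tabulate λ e → edgeInside X (ends e)

  ∈-span⁺ : ∀ {X e} → tail* G e Sub.∈ X → head* G e Sub.∈ X → e Sub.∈ span X
  ∈-span⁺ {X} {e} t∈X h∈X = VecP.lookup⇒[]= e (span X)
    (trans (VecP.lookup∘tabulate _ e) (∈⇒inside t∈X h∈X))

  ∈-span⁻ : ∀ {X e} → e Sub.∈ span X → tail* G e Sub.∈ X × head* G e Sub.∈ X
  ∈-span⁻ {X} {e} e∈ = inside⇒∈ {X = X} {tail* G e} {head* G e}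
    (trans (sym (VecP.lookup∘tabulate (λ e → edgeInside X (ends e)) e)) (VecP.[]=⇒lookup e∈))

  -- Links the count over a list, on which Henneberg's induction runs, with the cardinality of a
  -- subset, on which the circuit argument runs.
  induced-∩ : ∀ {k n} (S : Subset k) (f : Fin k → Edge n) X →
    induced X (map f (select S)) ≡ ∣ S ∩ Vec.tabulate (λ e → edgeInside X (f e)) ∣
  induced-∩ Vec.[]              f X = refl
  induced-∩ (true Vec.∷ S) f X = trans
    (cong (λ es → bit (edgeInside X (f zero)) ℕ.+ induced X es) (sym (map-∘ (select S))))
    (trans (cong (bit (edgeInside X (f zero)) ℕ.+_) (induced-∩ S (f ∘ suc) X)) (head (edgeInside X (f zero))))
    where
    head : ∀ b → bit b ℕ.+ ∣ S ∩ Vec.tabulate (λ e → edgeInside X (f (suc e))) ∣ ≡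
      ∣ b Vec.∷ (S ∩ Vec.tabulate (λ e → edgeInside X (f (suc e)))) ∣
    head true  = refl
    head false = refl
  induced-∩ (false Vec.∷ S) f X = trans (cong (induced X) (sym (map-∘ (select S)))) (induced-∩ S (f ∘ suc) X)

  anyFin-witness : ∀ {k} (f : Fin k → Bool) → anyFin f ≡ true → ∃ λ i → f i ≡ true
  anyFin-witness {suc k} f eq with f zero in f0
  ... | true  = zero , f0
  ... | false with i , fi ← anyFin-witness (f ∘ suc) eq = suc i , fi

  anyFin-∈ : ∀ {k l} (F : Subset k) (inc : Fin k → Fin l → Bool) {i} →
    i Sub.∈ Vec.tabulate (λ i → anyFin λ e → Vec.lookup F e ∧ inc e i) → ∃ λ e → e Sub.∈ F × inc e i ≡ true
  anyFin-∈ F inc {i} i∈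
    with e , eq ← anyFin-witness (λ e → Vec.lookup F e ∧ inc e i)
           (trans (sym (VecP.lookup∘tabulate (λ i → anyFin λ e → Vec.lookup F e ∧ inc e i) i)) (VecP.[]=⇒lookup i∈))
    with Vec.lookup F e in F-eq | inc e i in inc-eq
  ... | true | true = e , VecP.lookup⇒[]= e F F-eq , inc-eq

  incInner-end : ∀ e i → incInner G e i ≡ true → suc i ≡ tail* G e ⊎ suc i ≡ head* G e
  incInner-end e i eq with other G e
  ... | inj₂ _ = inj₁ (cong suc (sym (from-does (inner G e FinP.≟ i) eq)))
  ... | inj₁ j with inner G e FinP.≟ i | j FinP.≟ i
  ...   | yes refl | _        = inj₁ refl
  ...   | no _     | yes refl = inj₂ refl

  incPinned-end : ∀ e q → incPinned G e q ≡ true → head* G e ≡ zero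
  incPinned-end e q eq with other G e
  ... | inj₂ _ = refl

  -- `b` tells whether p* belongs to the vertex set, and `Y` is its inner part.
  innerOf-span : ∀ b Y {i} → i Sub.∈ innerOf G (span (b Vec.∷ Y)) → i Sub.∈ Y
  innerOf-span b Y {i} i∈ with e , e∈ , inc ← anyFin-∈ (span (b Vec.∷ Y)) (incInner G) i∈
    with t∈ , h∈ ← ∈-span⁻ {b Vec.∷ Y} e∈ | incInner-end e i inc
  ... | inj₁ eq = SubP.drop-there (subst (Sub._∈ b Vec.∷ Y) (sym eq) t∈)
  ... | inj₂ eq = SubP.drop-there (subst (Sub._∈ b Vec.∷ Y) (sym eq) h∈)

  pinnedOf-span : ∀ {X q} → q Sub.∈ pinnedOf G (span X) → zero Sub.∈ X
  pinnedOf-span {X} {q} q∈ with e , e∈ , inc ← anyFin-∈ (span X) (incPinned G) q∈ =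
    subst (Sub._∈ X) (incPinned-end e q inc) (proj₂ (∈-span⁻ e∈))

  module _ (pfc : PFC G) where
    open PFC pfc

    -- All three framework conditions collapse to one bound. Without pinned vertices `F` has at most
    -- 2|Y| - 3 edges. With one or more it has at most 2|Y|, and then p* lies in the vertex set,
    -- which has |Y| + 1 elements.
    span-bound : ∀ X → 1 ℕ.≤ ∣ span X ∣ → ∣ span X ∣ ℕ.+ 2 ℕ.≤ 2 ℕ.* ∣ X ∣
    span-bound (b Vec.∷ Y) nonempty = by-pinned ∣ pinnedOf G F ∣ refl
      where
      F = span (b Vec.∷ Y)
      F-nonempty = 1≤∣∣⇒nonempty F nonempty
      inner≤ : 2 ℕ.* ∣ innerOf G F ∣ ℕ.≤ 2 ℕ.* ∣ Y ∣
      inner≤ = ℕP.*-monoʳ-≤ 2 (SubP.p⊆q⇒∣p∣≤∣q∣ (innerOf-span b Y))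
      pinned-bound : ∣ F ∣ ℕ.≤ 2 ℕ.* ∣ innerOf G F ∣ → 1 ℕ.≤ ∣ pinnedOf G F ∣ → ∣ F ∣ ℕ.+ 2 ℕ.≤ 2 ℕ.* ∣ b Vec.∷ Y ∣
      pinned-bound F≤ pinned with VecP.[]=⇒lookup (pinnedOf-span {b Vec.∷ Y} (proj₂ (1≤∣∣⇒nonempty (pinnedOf G F) pinned)))
      -- The match forces `b` to be `true`: p* supplies the additional 2.
      ... | refl = ℕP.≤-trans (ℕP.+-monoˡ-≤ 2 (ℕP.≤-trans F≤ inner≤)) (ℕP.≤-reflexive (double ∣ Y ∣))
        where
        double : ∀ k → 2 ℕ.* k ℕ.+ 2 ≡ 2 ℕ.* suc k
        double = ℕSolver.solve-∀
      by-pinned : ∀ k → ∣ pinnedOf G F ∣ ≡ k → ∣ F ∣ ℕ.+ 2 ℕ.≤ 2 ℕ.* ∣ b Vec.∷ Y ∣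
      by-pinned zero eq =
        ℕP.≤-trans (ℕP.+-monoʳ-≤ (∣ F ∣) (ℕP.n≤1+n 2)) (ℕP.≤-trans (sparse0 F F-nonempty eq)
          (ℕP.≤-trans inner≤ (ℕP.*-monoʳ-≤ 2 (SubP.∣p∣≤∣x∷p∣ b Y))))
      by-pinned (suc zero) eq =
        pinned-bound (ℕP.≤-trans (ℕP.m≤m+n _ 1) (sparse1 F F-nonempty eq)) (ℕP.≤-reflexive (sym eq))
      by-pinned (suc (suc k)) eq =
        pinned-bound (sparse2 F F-nonempty (subst (2 ℕ.≤_) (sym eq) (ℕ.s≤s (ℕ.s≤s ℕ.z≤n))))
          (subst (1 ℕ.≤_) (sym eq) (ℕ.s≤s ℕ.z≤n))

    private
      span-mono : ∀ {X Y} → X ⊆ Y → span X ⊆ span Y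
      span-mono {X} {Y} X⊆Y e∈ with t∈ , h∈ ← ∈-span⁻ {X} e∈ = ∈-span⁺ {Y} (X⊆Y t∈) (X⊆Y h∈)

      span-∩ : ∀ {X Y e} → e Sub.∈ span X → e Sub.∈ span Y → e Sub.∈ span (X ∩ Y)
      span-∩ {X} {Y} e∈X e∈Y with t∈X , h∈X ← ∈-span⁻ {X} e∈X | t∈Y , h∈Y ← ∈-span⁻ {Y} e∈Y =
        ∈-span⁺ {X ∩ Y} (SubP.x∈p∩q⁺ (t∈X , t∈Y)) (SubP.x∈p∩q⁺ (h∈X , h∈Y))

      indep⇒sparse : ∀ {S} → Independent G S →
        ∀ X → 1 ℕ.≤ ∣ S ∩ span X ∣ → ∣ S ∩ span X ∣ ℕ.+ 3 ℕ.≤ 2 ℕ.* ∣ X ∣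
      indep⇒sparse {S} indep X =
        subst (λ k → 1 ℕ.≤ k → k ℕ.+ 3 ℕ.≤ 2 ℕ.* ∣ X ∣) (induced-∩ S ends X) (Laman.bound (independent⇒Laman S indep) X)

      sparse⇒indep : ∀ {S} → (∀ X → 1 ℕ.≤ ∣ S ∩ span X ∣ → ∣ S ∩ span X ∣ ℕ.+ 3 ℕ.≤ 2 ℕ.* ∣ X ∣) → Independent G S
      sparse⇒indep {S} bounded = Laman⇒independent S (sparse λ X →
        subst (λ k → 1 ℕ.≤ k → k ℕ.+ 3 ℕ.≤ 2 ℕ.* ∣ X ∣) (sym (induced-∩ S ends X)) (bounded X))

    open Circuits span (λ {X} {Y} → span-mono {X} {Y}) (λ {X} {Y} → span-∩ {X} {Y}) span-bound
      (Independent G) (λ {S} → indep⇒sparse {S}) (λ {S} → sparse⇒indep {S}) public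

-- The degree of freedom as a number of circuits.

open import Data.Integer using (+_; _-_)

theorem5 : (G : PinnedGraph) → PFC G →
    Σ (List (Subset (m G))) λ L → CircuitList G L ×
    (∃[ ρ ] (IsRank G ρ × DOF G ρ ≡ + length L - + 1))
theorem5 G pfc =
  circuits pfc , (circuits-unique pfc , λ C → mk⇔ (∈-circuits⁻ pfc) (∈-circuits⁺ pfc)) , rank (rank-witness pfc)
  where
  open IdentifiedGraph G
  open ≡-Reasoning
  k = length (circuits pfc)
  -- Here 2(|I| + 1) has become 2 + (r + k): the count condition gives 2|I| = |E|, and |E| is the
  -- rank r plus the number k of circuits.
  dof : ∀ r k → (+ 2 ℤ.+ (r ℤ.+ k)) - + 3 - r ≡ k - + 1
  dof = ℤSolver.solve-∀
  double : ∀ n → 2 ℕ.* suc n ≡ 2 ℕ.+ 2 ℕ.* n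
  double = ℕSolver.solve-∀
  rank : ∃ (λ S → Independent G S × m G ℕ.≤ ∣ S ∣ ℕ.+ k) → ∃[ ρ ] (IsRank G ρ × DOF G ρ ≡ + k - + 1)
  rank (S , indep , m≤) = ∣ S ∣ , ((S , indep , refl) , λ T T-indep →
      ℕP.+-cancelʳ-≤ k _ _ (ℕP.≤-trans (indep-bound pfc {T} T-indep) m≤)) , (begin
    + (2 ℕ.* suc (ni G)) - + 3 - + ∣ S ∣
      ≡⟨ cong (λ d → + d - + 3 - + ∣ S ∣) (trans (double (ni G)) (cong (2 ℕ.+_) (trans (sym (PFC.count pfc)) (sym ∣S∣+k)))) ⟩
    (+ 2 ℤ.+ (+ ∣ S ∣ ℤ.+ + k)) - + 3 - + ∣ S ∣
      ≡⟨ dof (+ ∣ S ∣) (+ k) ⟩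
    + k - + 1 ∎)
    where
    ∣S∣+k : ∣ S ∣ ℕ.+ k ≡ m G
    ∣S∣+k = ℕP.≤-antisym (indep-bound pfc {S} indep) m≤
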